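{- Let $S=\langle a_1,\dots,a_k\rangle\subset\mathbb{Z}_{\ge0}$ be a numerical monoid with $a_i\ne0$ for all $i$, and let $\mathcal{O}$ be the set of Apéry orderings with respect to $a_k$ on $\mathbb{Q}[x,y_1,\dots,y_k]$. Then $$\bigcap_{\prec\in\mathcal{O}}\partial_\prec(S,a_k)=T(S).$$
   Context: A numerical monoid is a set $S=\langle a_1,\dots,a_k\rangle=\{\lambda_1a_1+\dots+\lambda_ka_k\mid \lambda_i\in\mathbb{Z}_{\ge 0}\}$ with $a_i\in\mathbb{Z}_{\geq 0}$ and $\gcd(a_1,\dots,a_k)=1$. Apéry set: for $s\in S$, $s\neq 0$, $Ap(S,s)=\{0,w_1,\dots,w_{s-1}\}$, where $w_i$ is the smallest element of $S$ congruent to $i$ modulo $s$; equivalently $Ap(S,s)=\{x\in S\mid x-s\notin S\}$. Type set: $T(S)=\{m\in Ap(S,a_k)\mid m+a_i\notin Ap(S,a_k)\ \text{for all}\ i=1,\dots,k\}$. Ideal: $I_S=\langle y_1-x^{a_1},\dots,y_k-x^{a_k}\rangle\subset\mathbb{Q}[x,y_1,\dots,y_k]$. Exponents: for a monomial ordering $\prec$ and a nonzero polynomial $g=\sum a_{\underline\alpha}x^{\alpha_0}y_1^{\alpha_1}\cdots y_k^{\alpha_k}$, $\exp(g)=\max_\prec\{\underline\alpha\mid a_{\underline\alpha}\ne 0\}\in\mathbb{Z}_{\ge 0}^{k+1}$. Apéry ordering with respect to $a_k$: a monomial ordering on $\mathbb{Q}[x,y_1,\dots,y_k]$ which compares two monomials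 $x^{\alpha_0}y_1^{\alpha_1}\cdots y_k^{\alpha_k}$ by the following criteria, in succession (each used only to break ties in the previous ones; larger value means larger monomial): (1) the exponent $\alpha_0$ of $x$; (2) the weight $\sum_{i\ne k}\alpha_ia_i$; (3) an arbitrary (chosen) monomial ordering on the variables $y_1,\dots,y_{k-1}$; (4) the exponent $\alpha_k$ of $y_k$. Given an Apéry ordering $\prec$ with respect to $a_k$, let $\mathcal{B}=\{g_1,\dots,g_r\}$ be the reduced Groebner basis of $I_S$ with respect to $\prec$, let $N_k$ denote the normal form with respect to $\mathcal{B}$ (the normal form of a monomial is again a monomial), and put $E(I_S)=\bigcup_{i=1}^r\left(\exp(g_i)+\mathbb{Z}_{\ge 0}^{k+1}\right)$, $\overline{E(I_S)}=\mathbb{Z}_{\ge 0}^{k+1}\setminus E(I_S)$. Coordinates on $\mathbb{Z}_{\geq 0}^{k+1}$ are named after the variables. For $N\in Ap(S,a_k)$ one has $\exp(N_k(x^N))=(0,\gamma_1,\dots,\gamma_{k-1},0)$ for some $\gamma_i\in\mathbb{Z}_{\ge0}$. Such an $N$ is called an extremal element of $Ap(S,a_k)$ for $\prec$ if, for all $i=1,\dots,k$, the tuple obtained from $(0,\gamma_1,\dots,\gamma_{k-1},0)$ by adding $1$ to the $y_i$-coordinate does not belong to $\overline{E(I_S)}\cap\{x=y_k=0\}$ (for $i=k$ this is automatic). The set of extremal elements of $Ap(S,a_k)$ for $\prec$ is denoted $\partial_\prec(S,a_k)$. -}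

module Defs where

open import Data.Bool using (if_then_else_)
open import Data.Fin using (Fin)
open import Data.List as List using (List; []; _∷_)
open import Data.Nat using (ℕ; zero; suc; _+_; _*_; _<_)
open import Data.Nat.GCD using (gcd)
import Data.Nat.Properties as ℕₚ
open import Data.Product using (Σ; ∃-syntax; _×_; _,_)
open import Data.Product.Relation.Binary.Lex.Strict using (×-Lex)
import Data.Rational as ℚ
open ℚ using (ℚ; 0ℚ; 1ℚ)
open import Data.Sum using (_⊎_)
open import Data.Vec as Vec
  using (Vec; []; _∷_; _∷ʳ_; lookup; replicate; zipWith; tabulate; init; last; _[_]≔_)
import Data.Vec.Properties as Vecₚ
open import Function.Base using (_on_)
open import Function.Bundles using (_⇔_)
open import Induction.WellFounded using (WellFounded)
open import Level using (0ℓ)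
open import Relation.Binary.Core using (Rel)
open import Relation.Binary.PropositionalEquality using (_≡_; _≢_)
open import Relation.Binary.Structures using (IsStrictTotalOrder)
open import Relation.Nullary using (¬_)
open import Relation.Nullary.Decidable using (does)
open import Relation.Unary using (Pred; _∈_; _∉_; ∁; _∩_)

------------------------------------------------------------------------
-- Numerical monoids

dot : ∀ {m} → Vec ℕ m → Vec ℕ m → ℕ
dot u v = Vec.sum (zipWith _*_ u v)

gcds : ∀ {m} → Vec ℕ m → ℕ
gcds = Vec.foldr′ gcd 0

Generated : ∀ {m} → Vec ℕ m → Pred ℕ 0ℓ
Generated a N = ∃[ l ] N ≡ dot l a

-- { x ∈ S ∣ x - s ∉ S }, where the subtraction is that of ℤ.
Ap : Pred ℕ 0ℓ → ℕ → Pred ℕ 0ℓ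
Ap S s x = x ∈ S × ¬ (∃[ y ] y ∈ S × y + s ≡ x)

-- Writing k = suc n, the distinguished generator aₖ is the last entry.
T : ∀ {n} → Vec ℕ (suc n) → Pred ℕ 0ℓ
T a m = m ∈ Ap S aₖ × (∀ i → m + lookup a i ∉ Ap S aₖ)
  where
  S  = Generated a
  aₖ = last a

------------------------------------------------------------------------
-- Polynomials over ℚ in m variables

Exponent : ℕ → Set
Exponent m = Vec ℕ m

infixl 6 _⊕_
_⊕_ : ∀ {m} → Exponent m → Exponent m → Exponent m
_⊕_ = zipWith _+_

𝟎 : ∀ {m} → Exponent m
𝟎 = replicate _ 0

unit : ∀ {m} → Fin m → Exponent m
unit i = 𝟎 [ i ]≔ 1

-- A polynomial is a formal sum of terms.  Exponents may be repeated and
-- coefficients may vanish, so everything below goes through coeff, and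
-- equality of polynomials is _≈_.
Poly : ℕ → Set
Poly m = List (ℚ × Exponent m)

coeff : ∀ {m} → Poly m → Exponent m → ℚ
coeff []            α = 0ℚ
coeff ((c , β) ∷ p) α =
  (if does (Vecₚ.≡-dec ℕₚ._≟_ β α) then c else 0ℚ) ℚ.+ coeff p α

infix 4 _≈_
_≈_ : ∀ {m} → Poly m → Poly m → Set
p ≈ q = ∀ α → coeff p α ≡ coeff q α

monomial : ∀ {m} → Exponent m → Poly m
monomial α = (1ℚ , α) ∷ []

infixl 6 _+ᵖ_ _-ᵖ_
infixl 7 _*ᵖ_

_+ᵖ_ : ∀ {m} → Poly m → Poly m → Poly m
_+ᵖ_ = List._++_

-ᵖ_ : ∀ {m} → Poly m → Poly m
-ᵖ_ = List.map (λ (c , α) → ℚ.- c , α)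

_-ᵖ_ : ∀ {m} → Poly m → Poly m → Poly m
p -ᵖ q = p +ᵖ (-ᵖ q)

_*ᵖ_ : ∀ {m} → Poly m → Poly m → Poly m
_*ᵖ_ = List.cartesianProductWith (λ (c , α) (d , β) → c ℚ.* d , α ⊕ β)

-- The ideal generated by g₁ , … , gᵣ.
⟨_⟩ : ∀ {m r} → Vec (Poly m) r → Pred (Poly m) 0ℓ
⟨_⟩ {m} {r} gs f =
  Σ (Vec (Poly m) r) λ hs → f ≈ Vec.foldr′ _+ᵖ_ [] (zipWith _*ᵖ_ hs gs)

------------------------------------------------------------------------
-- Monomial orderings and Gröbner bases

record IsMonomialOrdering {m} (_≺_ : Rel (Exponent m) 0ℓ) : Set where
  field
    isStrictTotalOrder : IsStrictTotalOrder _≡_ _≺_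
    compatible         : ∀ {α β} γ → α ≺ β → (α ⊕ γ) ≺ (β ⊕ γ)
    wellFounded        : WellFounded _≺_

-- IsExp _≺_ g α says that g is nonzero and exp(g) = α.
IsExp : ∀ {m} → Rel (Exponent m) 0ℓ → Poly m → Pred (Exponent m) 0ℓ
IsExp _≺_ g α =
  coeff g α ≢ 0ℚ × (∀ β → coeff g β ≢ 0ℚ → β ≺ α ⊎ β ≡ α)

-- exp(g) + ℤ≥0ᵐ
ExpCone : ∀ {m} → Rel (Exponent m) 0ℓ → Poly m → Pred (Exponent m) 0ℓ
ExpCone _≺_ g α = ∃[ ε ] IsExp _≺_ g ε × (∃[ δ ] α ≡ ε ⊕ δ)

-- The union of the cones of the members of B; this is E(I) when B is a
-- Gröbner basis of I.
E : ∀ {m r} → Rel (Exponent m) 0ℓ → Vec (Poly m) r → Pred (Exponent m) 0ℓ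
E _≺_ B α = ∃[ i ] α ∈ ExpCone _≺_ (lookup B i)

record IsReducedGröbnerBasis {m r} (_≺_ : Rel (Exponent m) 0ℓ)
    (I : Pred (Poly m) 0ℓ) (B : Vec (Poly m) r) : Set where
  field
    contained : ∀ i → lookup B i ∈ I
    gröbner   : ∀ f α → f ∈ I → IsExp _≺_ f α → α ∈ E _≺_ B
    monic     : ∀ i → ∃[ α ] IsExp _≺_ (lookup B i) α × coeff (lookup B i) α ≡ 1ℚ
    reduced   : ∀ i j → i ≢ j → ∀ α → coeff (lookup B i) α ≢ 0ℚ →
                α ∉ ExpCone _≺_ (lookup B j)

-- r is the remainder of f modulo B: no monomial of r is divisible by a
-- leading monomial of B.  It is unique up to _≈_ when B is a Gröbner basis.
IsNormalForm : ∀ {m r} → Rel (Exponent m) 0ℓ → Vec (Poly m) r →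
               Poly m → Poly m → Set
IsNormalForm _≺_ B f r =
  (f -ᵖ r) ∈ ⟨ B ⟩ × (∀ α → coeff r α ≢ 0ℚ → α ∉ E _≺_ B)

------------------------------------------------------------------------
-- Apéry orderings and extremal elements

-- In ℚ[x, y₁, …, yₖ] the exponent of xᵅ⁰ y₁ᵅ¹ ⋯ yₖᵅᵏ is α₀ ∷ α₁ ∷ … ∷ αₖ ∷ [].

-- y₁ - x^a₁ , … , yₖ - x^aₖ
I-generators : ∀ {k} → Vec ℕ k → Vec (Poly (suc k)) k
I-generators a =
  tabulate λ i → monomial (0 ∷ unit i) -ᵖ monomial (lookup a i ∷ 𝟎)

I⟨_⟩ : ∀ {k} → Vec ℕ k → Pred (Poly (suc k)) 0ℓ
I⟨ a ⟩ = ⟨ I-generators a ⟩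

-- The data compared by the four criteria, in order of precedence.
criteria : ∀ {n} → Vec ℕ (suc n) → Exponent (suc (suc n)) →
           ℕ × ℕ × Exponent n × ℕ
criteria a (α₀ ∷ αs) = α₀ , dot (init αs) (init a) , init αs , last αs

AperyLex : ∀ {n} → Vec ℕ (suc n) → Rel (Exponent n) 0ℓ →
           Rel (Exponent (suc (suc n))) 0ℓ
AperyLex a _⊏_ =
  ×-Lex _≡_ _<_ (×-Lex _≡_ _<_ (×-Lex _≡_ _⊏_ _<_)) on criteria a

record AperyOrdering {n} (a : Vec ℕ (suc n)) : Set₁ where
  field
    _≺_                : Rel (Exponent (suc (suc n))) 0ℓ
    isMonomialOrdering : IsMonomialOrdering _≺_
    _⊏_                : Rel (Exponent n) 0ℓ
    ⊏-isMonomialOrdering : IsMonomialOrdering _⊏_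
    compares           : ∀ α β → α ≺ β ⇔ AperyLex a _⊏_ α β

-- The coordinate subspace x = yₖ = 0.
x=yₖ=0 : ∀ {n} → Pred (Exponent (suc (suc n))) 0ℓ
x=yₖ=0 (α₀ ∷ αs) = α₀ ≡ 0 × last αs ≡ 0

IsExtremal : ∀ {n r} (a : Vec ℕ (suc n)) → Rel (Exponent (suc (suc n))) 0ℓ →
             Vec (Poly (suc (suc n))) r → Pred ℕ 0ℓ
IsExtremal {n} a _≺_ B N =
  N ∈ Ap (Generated a) (last a) ×
  (∃[ p ] IsNormalForm _≺_ B (monomial (N ∷ 𝟎)) p ×
    Σ (Exponent n) λ γ →
      IsExp _≺_ p (0 ∷ (γ ∷ʳ 0)) ×
      (∀ i → 0 ∷ ((γ ∷ʳ 0) ⊕ unit i) ∉ ∁ (E _≺_ B) ∩ x=yₖ=0))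

-- The existential picks out the reduced Gröbner basis, which is unique up to
-- the order of its members (and _≈_ on each of them).
∂ : ∀ {n} (a : Vec ℕ (suc n)) → AperyOrdering a → Pred ℕ 0ℓ
∂ {n} a O N =
  Σ ℕ λ r → Σ (Vec (Poly (suc (suc n))) r) λ B →
    IsReducedGröbnerBasis _≺_ I⟨ a ⟩ B × N ∈ IsExtremal a _≺_ B
  where open AperyOrdering O

{-# OPTIONS --safe #-}

-- Grade ℚ[x, y₁, …, yₖ] by deg x = 1, deg yᵢ = aᵢ.  Since I_S is the toric ideal
-- of this grading, a monomial lies in E(I_S) iff it is not the ≺-smallest one of
-- its degree, so N is extremal iff no yᵢ · N_k(x^N) with i < k is the smallest
-- monomial of degree N + aᵢ.  A smallest monomial free of x and yₖ has its degree
-- in Ap(S, aₖ), as otherwise some monomial of that degree contains yₖ and has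
-- smaller weight; hence T(S) ⊆ ∂_≺(S, aₖ) for all ≺.  Conversely, if N + aᵢ lies in
-- Ap(S, aₖ), choose ≺ so that smallest monomials have the largest possible
-- exponent of yᵢ: then the smallest monomial of degree N + aᵢ is yᵢ · N_k(x^N),
-- and N is not extremal for ≺.

module Submission where

open import Defs
open import Algebra.Bundles using (CommutativeMonoid)
open import Data.Bool using (true; false; if_then_else_)
open import Data.Empty using (⊥)
open import Data.Fin as Fin using (Fin; zero; suc)
open import Data.List as List using (List; []; _∷_; _++_)
open import Data.List.Membership.Propositional using (find; lose) renaming (_∈_ to _∈ₗ_)
open import Data.List.Membership.Propositional.Properties
  using (∈-cartesianProductWith⁺; ∈-upTo⁺; ∈-filter⁺; ∈-filter⁻;
         ∈-deduplicate⁺; ∈-deduplicate⁻; ∈-lookup)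
import Data.List.Properties as Listₚ
open import Data.List.Relation.Unary.All as All using ()
open import Data.List.Relation.Unary.AllPairs using (_∷_)
open import Data.List.Relation.Unary.Any as Any using (here; there)
open import Data.List.Relation.Unary.Any.Properties using (lookup-index)
open import Data.List.Relation.Unary.Unique.Propositional using (Unique)
import Data.List.Relation.Unary.Unique.DecPropositional.Properties as UniqueDec
open import Data.Nat
  using (ℕ; zero; suc; _+_; _*_; _≤_; _<_; _≤?_; z≤n; s≤s; NonZero; ≢-nonZero⁻¹)
open import Data.Nat.Induction using (<-wellFounded)
import Data.Nat.Properties as ℕₚ
open import Data.Nat.Solver using (module +-*-Solver)
open import Data.Product as Prod using (∃-syntax; _×_; _,_; proj₁; proj₂)
open import Data.Product.Relation.Binary.Lex.Strict
  using (×-Lex; ×-isStrictTotalOrder; ×-wellFounded)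
import Data.Rational as ℚ
open ℚ using (ℚ; 0ℚ; 1ℚ)
import Data.Rational.Properties as ℚₚ
open import Data.Sum as Sum using (_⊎_; inj₁; inj₂)
open import Data.Vec as Vec
  using (Vec; []; _∷_; _∷ʳ_; lookup; zipWith; init; last; _[_]≔_)
import Data.Vec.Properties as Vecₚ
open import Function.Base using (_∘_; _on_; id)
open import Function.Bundles using (Equivalence; mk⇔)
open import Induction.WellFounded using (Acc; acc)
open import Level using (0ℓ)
import Relation.Binary.Construct.On as On
open import Relation.Binary.Core using (Rel)
open import Relation.Binary.Definitions using (tri<; tri≈; tri>)
open import Relation.Binary.PropositionalEquality
open import Relation.Binary.Structures using (IsStrictTotalOrder)
open import Relation.Nullary using (¬_; Dec; yes; no; contradiction)
open import Relation.Nullary.Decidable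
  using (does; map′; dec-true; dec-false; _×-dec_; ¬?; decidable-stable)
open import Relation.Unary using (Pred; Decidable; _∈_; _∉_; ∁; _∩_; ⋂; _≐_)

open import Algebra.Properties.CommutativeSemigroup
  (CommutativeMonoid.commutativeSemigroup ℚₚ.+-0-commutativeMonoid)
  using () renaming (interchange to +-interchange)

-- `∂` asserts that a reduced Gröbner basis exists, so T(S) ⊆ ∂_≺(S, aₖ) obliges the proof to
-- exhibit one for every ≺, and finiteness is the obstacle. E(I_S) is replaced by the basis-free
-- predicate `Reducible`, which is decidable because positive weights leave only finitely many
-- monomials in each degree. The basis consists of the binomials ε - `nf` ε, for ε reducible and
-- minimal under divisibility. That there are finitely many such ε follows not from Dickson's lemma
-- but from an explicit degree bound: x^aₖ and yᵢ^aₖ with i < k are reducible, having the degrees of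
-- yₖ and yₖ^aᵢ. In the converse inclusion the basis is given and arbitrary, and its E is shown to
-- coincide with `Reducible`. That I_S is toric enters through two facts: its elements vanish under
-- x^α ↦ t^(deg α), and it contains every binomial whose two terms have equal degree.

private variable
  n m r : ℕ

-- Exponent vectors

⊕-comm : (α β : Exponent m) → α ⊕ β ≡ β ⊕ α
⊕-comm = Vecₚ.zipWith-comm ℕₚ.+-comm

⊕-assoc : (α β γ : Exponent m) → (α ⊕ β) ⊕ γ ≡ α ⊕ (β ⊕ γ)
⊕-assoc = Vecₚ.zipWith-assoc ℕₚ.+-assoc

⊕-identityʳ : (α : Exponent m) → α ⊕ 𝟎 ≡ α
⊕-identityʳ = Vecₚ.zipWith-identityʳ ℕₚ.+-identityʳ

⊕-identityˡ : (α : Exponent m) → 𝟎 ⊕ α ≡ α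
⊕-identityˡ = Vecₚ.zipWith-identityˡ ℕₚ.+-identityˡ

⊕-cancelˡ : (γ : Exponent m) {α β : Exponent m} → γ ⊕ α ≡ γ ⊕ β → α ≡ β
⊕-cancelˡ []      {[]}    {[]}    _  = refl
⊕-cancelˡ (c ∷ γ) {a ∷ α} {b ∷ β} eq =
  cong₂ _∷_ (ℕₚ.+-cancelˡ-≡ c a b (Vecₚ.∷-injectiveˡ eq))
            (⊕-cancelˡ γ (Vecₚ.∷-injectiveʳ eq))

dot-⊕ : (α β w : Vec ℕ m) → dot (α ⊕ β) w ≡ dot α w + dot β w
dot-⊕ []      []      []      = refl
dot-⊕ (a ∷ α) (b ∷ β) (c ∷ w) rewrite dot-⊕ α β w =
  solve 5 (λ a b c x y → (a :+ b) :* c :+ (x :+ y) := (a :* c :+ x) :+ (b :* c :+ y))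
    refl a b c (dot α w) (dot β w)
  where open +-*-Solver

dot-𝟎 : (w : Vec ℕ m) → dot 𝟎 w ≡ 0
dot-𝟎 []      = refl
dot-𝟎 (_ ∷ w) = dot-𝟎 w

power : Fin m → ℕ → Exponent m
power i c = 𝟎 [ i ]≔ c

dot-power : ∀ (i : Fin m) c w → dot (power i c) w ≡ c * lookup w i
dot-power zero    c (b ∷ w) rewrite dot-𝟎 w = ℕₚ.+-identityʳ (c * b)
dot-power (suc i) c (b ∷ w) = dot-power i c w

dot-unit : ∀ (i : Fin m) w → dot (unit i) w ≡ lookup w i
dot-unit i w = trans (dot-power i 1 w) (ℕₚ.*-identityˡ _)

infix 4 _∣_ _∣?_

_∣_ : Exponent m → Exponent m → Set
β ∣ α = ∃[ δ ] α ≡ β ⊕ δ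

_∣?_ : (β α : Exponent m) → Dec (β ∣ α)
[]      ∣? []      = yes ([] , refl)
(b ∷ β) ∣? (a ∷ α) =
  map′ (λ { (b≤a , δ , refl) → _ ∷ δ , cong (_∷ _) (sym (ℕₚ.m+[n∸m]≡n b≤a)) })
       (λ { (d ∷ δ , refl) → ℕₚ.m≤m+n b d , δ , refl })
       ((b ≤? a) ×-dec (β ∣? α))

power-∣ : ∀ (i : Fin m) c α → c ≤ lookup α i → power i c ∣ α
power-∣ zero    c (a ∷ α) c≤a =
  _ ∷ α , cong₂ _∷_ (sym (ℕₚ.m+[n∸m]≡n c≤a)) (sym (⊕-identityˡ α))
power-∣ (suc i) c (a ∷ α) c≤αᵢ with power-∣ i c α c≤αᵢ
... | δ , eq = a ∷ δ , cong (a ∷_) eq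

dot≤*sum : ∀ c (α w : Vec ℕ m) → (∀ i → lookup α i ≤ c) → dot α w ≤ c * Vec.sum w
dot≤*sum c []      []      _  = z≤n
dot≤*sum c (a ∷ α) (b ∷ w) α≤ =
  subst (a * b + dot α w ≤_) (sym (ℕₚ.*-distribˡ-+ c b (Vec.sum w)))
    (ℕₚ.+-mono-≤ (ℕₚ.*-monoˡ-≤ b (α≤ zero)) (dot≤*sum c α w (α≤ ∘ suc)))

-- Induction on a monomial, one variable at a time; `to-x` uses it to trade the yᵢ for powers of x.
exponent-induction : (P : Exponent m → Set) → P 𝟎 →
                     (∀ i α → P α → P (unit i ⊕ α)) → ∀ α → P α
exponent-induction {zero}  P P𝟎 step []      = P𝟎
exponent-induction {suc m} P P𝟎 step (c ∷ α) = raise c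
  where
  raise : ∀ c → P (c ∷ α)
  raise zero    = exponent-induction (P ∘ (0 ∷_)) P𝟎 (λ i β → step (suc i) (0 ∷ β)) α
  raise (suc c) = subst (λ β → P (suc c ∷ β)) (⊕-identityˡ α) (step zero (c ∷ α) (raise c))

box : ℕ → List (Exponent m)
box {zero}  d = [] ∷ []
box {suc m} d = List.cartesianProductWith _∷_ (List.upTo (suc d)) (box d)

PositiveWeight : Vec ℕ m → Set
PositiveWeight w = ∀ i → NonZero (lookup w i)

deg≡0⇒𝟎 : (w : Vec ℕ m) → PositiveWeight w → ∀ α → dot α w ≡ 0 → α ≡ 𝟎
deg≡0⇒𝟎 []      pos []      _  = refl
deg≡0⇒𝟎 (b ∷ w) pos (a ∷ α) eq =
  cong₂ _∷_
    (ℕₚ.m*n≡0⇒m≡0 a b {{pos zero}} (ℕₚ.m+n≡0⇒m≡0 (a * b) eq))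
    (deg≡0⇒𝟎 w (pos ∘ suc) α (ℕₚ.m+n≡0⇒n≡0 (a * b) eq))

-- A positive weight b gives a ≤ a * b, so no coordinate exceeds the total weight. Hence every
-- search of bounded degree is finite.
∈-box : (w : Vec ℕ m) → PositiveWeight w → ∀ {d} α → dot α w ≤ d → α ∈ₗ box d
∈-box []      pos []      _  = here refl
∈-box (b ∷ w) pos (a ∷ α) le =
  ∈-cartesianProductWith⁺ _∷_
    (∈-upTo⁺ (s≤s (ℕₚ.≤-trans (ℕₚ.m≤m*n a b {{pos zero}}) (ℕₚ.m+n≤o⇒m≤o (a * b) le))))
    (∈-box w (pos ∘ suc) α (ℕₚ.m+n≤o⇒n≤o (a * b) le))

∃-bounded? : (w : Vec ℕ m) → PositiveWeight w → ∀ d {P : Pred (Exponent m) 0ℓ} →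
             (∀ α → P α → dot α w ≤ d) → Decidable P → Dec (∃[ α ] P α)
∃-bounded? w pos d bound P? =
  map′ Any.satisfied
       (λ (α , Pα) → Any.map (λ { refl → Pα }) (∈-box w pos α (bound α Pα)))
       (Any.any? P? (box d))

-- Polynomials and ideals

_≟ᵉ_ : (α β : Exponent m) → Dec (α ≡ β)
_≟ᵉ_ = Vecₚ.≡-dec ℕₚ._≟_

coeff-∷-≡ : ∀ c (α : Exponent m) p → coeff ((c , α) ∷ p) α ≡ c ℚ.+ coeff p α
coeff-∷-≡ c α p rewrite dec-true (α ≟ᵉ α) refl = refl

coeff-∷-≢ : ∀ c {β α : Exponent m} p → β ≢ α → coeff ((c , β) ∷ p) α ≡ coeff p α
coeff-∷-≢ c {β} {α} p β≢α rewrite dec-false (β ≟ᵉ α) β≢α = ℚₚ.+-identityˡ _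

coeff-++ : ∀ (p q : Poly m) α → coeff (p ++ q) α ≡ coeff p α ℚ.+ coeff q α
coeff-++ []            q α = sym (ℚₚ.+-identityˡ _)
coeff-++ ((c , β) ∷ p) q α rewrite coeff-++ p q α =
  sym (ℚₚ.+-assoc (if does (β ≟ᵉ α) then c else 0ℚ) (coeff p α) (coeff q α))

coeff-neg : ∀ (p : Poly m) α → coeff (-ᵖ p) α ≡ ℚ.- coeff p α
coeff-neg []            α = refl
coeff-neg ((c , β) ∷ p) α rewrite coeff-neg p α with does (β ≟ᵉ α)
... | true  = sym (ℚₚ.neg-distrib-+ c (coeff p α))
... | false = sym (ℚₚ.neg-distrib-+ 0ℚ (coeff p α))

binomial : Exponent m → Exponent m → Poly m
binomial α β = monomial α -ᵖ monomial β

coeff-monomial : (α : Exponent m) → coeff (monomial α) α ≡ 1ℚ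
coeff-monomial α = trans (coeff-∷-≡ 1ℚ α []) (ℚₚ.+-identityʳ 1ℚ)

monomial-support : ∀ {α β : Exponent m} → coeff (monomial α) β ≢ 0ℚ → β ≡ α
monomial-support {α = α} {β} β∈supp with α ≟ᵉ β
... | yes α≡β = sym α≡β
... | no  _   = contradiction refl β∈supp

coeff-binomial : ∀ {α β : Exponent m} → β ≢ α → coeff (binomial α β) α ≡ 1ℚ
coeff-binomial {α = α} {β} β≢α =
  trans (coeff-∷-≡ 1ℚ α (-ᵖ monomial β)) (cong (1ℚ ℚ.+_) (coeff-∷-≢ (ℚ.- 1ℚ) [] β≢α))

binomial-self : (α : Exponent m) → binomial α α ≈ []
binomial-self α β with α ≟ᵉ β
... | yes _ = refl
... | no  _ = refl

binomial-support : ∀ {α β γ : Exponent m} → coeff (binomial α β) γ ≢ 0ℚ →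
                   γ ≡ α ⊎ γ ≡ β
binomial-support {α = α} {β} {γ} γ∈supp with α ≟ᵉ γ | β ≟ᵉ γ
... | yes α≡γ | _       = inj₁ (sym α≡γ)
... | no  _   | yes β≡γ = inj₂ (sym β≡γ)
... | no  _   | no  _   = contradiction refl γ∈supp

*ᵖ-distribʳ : ∀ (h k g : Poly m) → (h +ᵖ k) *ᵖ g ≡ (h *ᵖ g) +ᵖ (k *ᵖ g)
*ᵖ-distribʳ = Listₚ.cartesianProductWith-distribʳ-++ _

neg-*ᵖ : ∀ (h g : Poly m) → (-ᵖ h) *ᵖ g ≡ -ᵖ (h *ᵖ g)
neg-*ᵖ []            g = refl
neg-*ᵖ ((c , α) ∷ h) g = trans
  (cong₂ _++_ (trans (Listₚ.map-cong (λ (d , β) → cong (_, α ⊕ β) (sym (ℚₚ.neg-distribˡ-* c d))) g)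
                     (Listₚ.map-∘ g))
              (neg-*ᵖ h g))
  (sym (Listₚ.map-++ _ _ (h *ᵖ g)))

module Ideal (m : ℕ) where

  combination : Vec (Poly m) r → Vec (Poly m) r → Poly m
  combination hs gs = Vec.foldr′ _+ᵖ_ [] (zipWith _*ᵖ_ hs gs)

  -- Only up to `_≈_`, unlike `combination-neg`: the two formal sums list the same terms in
  -- different orders.
  combination-+ : ∀ (hs ks gs : Vec (Poly m) r) →
    combination (zipWith _+ᵖ_ hs ks) gs ≈ combination hs gs +ᵖ combination ks gs
  combination-+ []       []       []       α = refl
  combination-+ (h ∷ hs) (k ∷ ks) (g ∷ gs) α
    rewrite *ᵖ-distribʳ h k g
          | coeff-++ (h *ᵖ g ++ k *ᵖ g) (combination (zipWith _+ᵖ_ hs ks) gs) α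
          | coeff-++ (h *ᵖ g) (k *ᵖ g) α
          | combination-+ hs ks gs α
          | coeff-++ (combination hs gs) (combination ks gs) α
          | coeff-++ (h *ᵖ g ++ combination hs gs) (k *ᵖ g ++ combination ks gs) α
          | coeff-++ (h *ᵖ g) (combination hs gs) α
          | coeff-++ (k *ᵖ g) (combination ks gs) α
    = +-interchange (coeff (h *ᵖ g) α) (coeff (k *ᵖ g) α) (coeff (combination hs gs) α) _

  combination-neg : ∀ (hs gs : Vec (Poly m) r) →
    combination (Vec.map -ᵖ_ hs) gs ≡ -ᵖ combination hs gs
  combination-neg []       []       = refl
  combination-neg (h ∷ hs) (g ∷ gs) = trans
    (cong₂ _++_ (neg-*ᵖ h g) (combination-neg hs gs))
    (sym (Listₚ.map-++ _ (h *ᵖ g) _))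

  combination-[] : ∀ (gs : Vec (Poly m) r) → combination (Vec.replicate r []) gs ≡ []
  combination-[] []       = refl
  combination-[] (g ∷ gs) = combination-[] gs

  combination-generator : ∀ (gs : Vec (Poly m) r) i h →
    combination (Vec.replicate r [] [ i ]≔ h) gs ≡ h *ᵖ lookup gs i
  combination-generator (g ∷ gs) zero    h =
    trans (cong (h *ᵖ g ++_) (combination-[] gs)) (Listₚ.++-identityʳ _)
  combination-generator (g ∷ gs) (suc i) h = combination-generator gs i h

  module _ {gs : Vec (Poly m) r} where

    ideal-resp-≈ : ∀ f g → f ≈ g → g ∈ ⟨ gs ⟩ → f ∈ ⟨ gs ⟩
    ideal-resp-≈ f g f≈g (hs , g≈) = hs , λ α → trans (f≈g α) (g≈ α)

    ideal-[] : [] ∈ ⟨ gs ⟩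
    ideal-[] = Vec.replicate r [] , λ α → cong (λ p → coeff p α) (sym (combination-[] gs))

    ideal-+ : ∀ f g → f ∈ ⟨ gs ⟩ → g ∈ ⟨ gs ⟩ → f +ᵖ g ∈ ⟨ gs ⟩
    ideal-+ f g (hs , f≈) (ks , g≈) = zipWith _+ᵖ_ hs ks , λ α → begin
      coeff (f ++ g) α                                   ≡⟨ coeff-++ f g α ⟩
      coeff f α ℚ.+ coeff g α                            ≡⟨ cong₂ ℚ._+_ (f≈ α) (g≈ α) ⟩
      coeff (combination hs gs) α ℚ.+ coeff (combination ks gs) α
                                                         ≡⟨ coeff-++ (combination hs gs) _ α ⟨
      coeff (combination hs gs ++ combination ks gs) α   ≡⟨ combination-+ hs ks gs α ⟨
      coeff (combination (zipWith _+ᵖ_ hs ks) gs) α      ∎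
      where open ≡-Reasoning

    ideal-neg : ∀ f → f ∈ ⟨ gs ⟩ → -ᵖ f ∈ ⟨ gs ⟩
    ideal-neg f (hs , f≈) = Vec.map -ᵖ_ hs , λ α → begin
      coeff (-ᵖ f) α                            ≡⟨ coeff-neg f α ⟩
      ℚ.- coeff f α                             ≡⟨ cong ℚ.-_ (f≈ α) ⟩
      ℚ.- coeff (combination hs gs) α           ≡⟨ coeff-neg (combination hs gs) α ⟨
      coeff (-ᵖ combination hs gs) α            ≡⟨ cong (λ p → coeff p α) (combination-neg hs gs) ⟨
      coeff (combination (Vec.map -ᵖ_ hs) gs) α ∎
      where open ≡-Reasoning

    ideal-multiple : ∀ i h → h *ᵖ lookup gs i ∈ ⟨ gs ⟩
    ideal-multiple i h = (Vec.replicate r [] [ i ]≔ h) ,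
      λ α → cong (λ p → coeff p α) (sym (combination-generator gs i h))

    binomial-refl : ∀ α → binomial α α ∈ ⟨ gs ⟩
    binomial-refl α = ideal-resp-≈ (binomial α α) [] (binomial-self α) ideal-[]

    -- With reflexivity and symmetry, this makes membership of binomials an equivalence of
    -- monomials, so later proofs chain rewriting steps instead of manipulating polynomials.
    binomial-trans : ∀ α β γ → binomial α β ∈ ⟨ gs ⟩ → binomial β γ ∈ ⟨ gs ⟩ →
                     binomial α γ ∈ ⟨ gs ⟩
    binomial-trans α β γ αβ βγ = ideal-resp-≈
      (binomial α γ) (binomial α β +ᵖ binomial β γ) telescope
      (ideal-+ (binomial α β) (binomial β γ) αβ βγ)
      where
      telescope : binomial α γ ≈ binomial α β +ᵖ binomial β γ
      -- Once it is known which exponents equal δ, both sides are closed rationals that compute.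
      telescope δ with α ≟ᵉ δ | β ≟ᵉ δ | γ ≟ᵉ δ
      ... | yes _ | yes _ | yes _ = refl
      ... | yes _ | yes _ | no  _ = refl
      ... | yes _ | no  _ | yes _ = refl
      ... | yes _ | no  _ | no  _ = refl
      ... | no  _ | yes _ | yes _ = refl
      ... | no  _ | yes _ | no  _ = refl
      ... | no  _ | no  _ | yes _ = refl
      ... | no  _ | no  _ | no  _ = refl

    binomial-sym : ∀ α β → binomial α β ∈ ⟨ gs ⟩ → binomial β α ∈ ⟨ gs ⟩
    binomial-sym α β αβ =
      ideal-resp-≈ (binomial β α) (-ᵖ binomial α β) flipped (ideal-neg (binomial α β) αβ)
      where
      flipped : binomial β α ≈ -ᵖ binomial α β
      flipped δ with α ≟ᵉ δ | β ≟ᵉ δ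
      ... | yes _ | yes _ = refl
      ... | yes _ | no  _ = refl
      ... | no  _ | yes _ = refl
      ... | no  _ | no  _ = refl

    binomial-multiple : ∀ i {ε ε′} → lookup gs i ≡ binomial ε ε′ → ∀ δ →
                        binomial (ε ⊕ δ) (ε′ ⊕ δ) ∈ ⟨ gs ⟩
    binomial-multiple i {ε} {ε′} gᵢ≡ δ =
      subst₂ (λ α β → binomial α β ∈ ⟨ gs ⟩) (⊕-comm δ ε) (⊕-comm δ ε′)
        (subst (λ g → monomial δ *ᵖ g ∈ ⟨ gs ⟩) gᵢ≡ (ideal-multiple i (monomial δ)))

-- The grading of a polynomial ring by positive weights

-- One row of a product: `(t ∷ p) *ᵖ q` unfolds to `term-* t q ++ p *ᵖ q`.
term-* : ℚ × Exponent m → Poly m → Poly m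
term-* (c , δ) = List.map (λ (d , β) → c ℚ.* d , δ ⊕ β)

coeff-term-* : ∀ c (δ : Exponent m) q α →
               coeff (term-* (c , δ) q) (δ ⊕ α) ≡ c ℚ.* coeff q α
coeff-term-* c δ []            α = sym (ℚₚ.*-zeroʳ c)
coeff-term-* c δ ((d , β) ∷ q) α with β ≟ᵉ α
... | yes refl = begin
  coeff ((c ℚ.* d , δ ⊕ β) ∷ term-* (c , δ) q) (δ ⊕ β)
    ≡⟨ coeff-∷-≡ (c ℚ.* d) (δ ⊕ β) (term-* (c , δ) q) ⟩
  c ℚ.* d ℚ.+ coeff (term-* (c , δ) q) (δ ⊕ β)
    ≡⟨ cong (c ℚ.* d ℚ.+_) (coeff-term-* c δ q β) ⟩
  c ℚ.* d ℚ.+ c ℚ.* coeff q β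
    ≡⟨ ℚₚ.*-distribˡ-+ c d (coeff q β) ⟨
  c ℚ.* (d ℚ.+ coeff q β) ∎
  where open ≡-Reasoning
... | no β≢α = begin
  coeff ((c ℚ.* d , δ ⊕ β) ∷ term-* (c , δ) q) (δ ⊕ α)
    ≡⟨ coeff-∷-≢ (c ℚ.* d) (term-* (c , δ) q) (β≢α ∘ ⊕-cancelˡ δ) ⟩
  coeff (term-* (c , δ) q) (δ ⊕ α)
    ≡⟨ coeff-term-* c δ q α ⟩
  c ℚ.* coeff q α
    ≡⟨ cong (c ℚ.*_) (ℚₚ.+-identityˡ (coeff q α)) ⟨
  c ℚ.* (0ℚ ℚ.+ coeff q α) ∎
  where open ≡-Reasoning

coeff-term-*-∤ : ∀ c {δ : Exponent m} q {α} → ¬ δ ∣ α → coeff (term-* (c , δ) q) α ≡ 0ℚ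
coeff-term-*-∤ c {δ} []            δ∤α = refl
coeff-term-*-∤ c {δ} ((d , β) ∷ q) δ∤α = trans
  (coeff-∷-≢ (c ℚ.* d) (term-* (c , δ) q) λ δβ≡α → δ∤α (β , sym δβ≡α))
  (coeff-term-*-∤ c q δ∤α)

-- A formal sum can vanish without being empty, as the image t^d - t^d of a generator does, so this
-- is checked coefficientwise: exponents divisible by δ get a multiple of a coefficient of q, the
-- others get nothing.
term-*-≈[] : ∀ t (q : Poly m) → q ≈ [] → term-* t q ≈ []
term-*-≈[] (c , δ) q q≈[] α with δ ∣? α
... | yes (α′ , refl) =
  trans (coeff-term-* c δ q α′) (trans (cong (c ℚ.*_) (q≈[] α′)) (ℚₚ.*-zeroʳ c))
... | no δ∤α = coeff-term-*-∤ c q δ∤α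

++-≈[] : ∀ (p q : Poly m) → p ≈ [] → q ≈ [] → p ++ q ≈ []
++-≈[] p q p≈[] q≈[] α = trans (coeff-++ p q α) (cong₂ ℚ._+_ (p≈[] α) (q≈[] α))

*ᵖ-≈[] : ∀ (p q : Poly m) → q ≈ [] → p *ᵖ q ≈ []
*ᵖ-≈[] []      q q≈[] α = refl
*ᵖ-≈[] (t ∷ p) q q≈[] =
  ++-≈[] (term-* t q) (p *ᵖ q) (term-*-≈[] t q q≈[]) (*ᵖ-≈[] p q q≈[])

-- Sums over the monomials of one degree

module _ {A : Set} where

  sumOver : List A → (A → ℚ) → ℚ
  sumOver L g = List.foldr (λ a s → g a ℚ.+ s) 0ℚ L

  sumOver-+ : ∀ L g h → sumOver L (λ a → g a ℚ.+ h a) ≡ sumOver L g ℚ.+ sumOver L h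
  sumOver-+ []      g h = refl
  sumOver-+ (a ∷ L) g h = trans (cong ((g a ℚ.+ h a) ℚ.+_) (sumOver-+ L g h))
    (+-interchange (g a) (h a) (sumOver L g) (sumOver L h))

  sumOver-cong : ∀ L {g h} → (∀ a → g a ≡ h a) → sumOver L g ≡ sumOver L h
  sumOver-cong []      g≗h = refl
  sumOver-cong (a ∷ L) g≗h = cong₂ ℚ._+_ (g≗h a) (sumOver-cong L g≗h)

  sumOver-0 : ∀ L g → (∀ a → a ∈ₗ L → g a ≡ 0ℚ) → sumOver L g ≡ 0ℚ
  sumOver-0 []      g g≡0 = refl
  sumOver-0 (a ∷ L) g g≡0 =
    cong₂ ℚ._+_ (g≡0 a (here refl)) (sumOver-0 L g (λ b → g≡0 b ∘ there))

  sumOver-point : ∀ {L} g {b} → Unique L → b ∈ₗ L →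
                  (∀ a → a ∈ₗ L → a ≢ b → g a ≡ 0ℚ) → sumOver L g ≡ g b
  sumOver-point {_ ∷ L} g {b} (b∉L ∷ _) (here refl) g≡0 = trans
    (cong (g b ℚ.+_) (sumOver-0 L g λ a a∈L →
      g≡0 a (there a∈L) (≢-sym (All.lookup b∉L a∈L))))
    (ℚₚ.+-identityʳ (g b))
  sumOver-point {x ∷ L} g {b} (x∉L ∷ uL) (there b∈L) g≡0 = trans
    (cong₂ ℚ._+_ (g≡0 x (here refl) (All.lookup x∉L b∈L))
      (sumOver-point g uL b∈L (λ a → g≡0 a ∘ there)))
    (ℚₚ.+-identityˡ (g b))

module Pushforward (w : Vec ℕ m) (w>0 : PositiveWeight w) where

  deg : Exponent m → ℕ
  deg α = dot α w

  -- The ring homomorphism x^α ↦ t^(deg α).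
  push : Poly m → Poly 1
  push = List.map λ (c , α) → c , deg α ∷ []

  push-++ : ∀ p q → push (p ++ q) ≡ push p ++ push q
  push-++ = Listₚ.map-++ _

  push-* : ∀ p q → push (p *ᵖ q) ≡ push p *ᵖ push q
  push-* []            q = refl
  push-* ((c , α) ∷ p) q = trans (push-++ (term-* (c , α) q) (p *ᵖ q))
    (cong₂ _++_ (push-term q) (push-* p q))
    where
    push-term : ∀ q → push (term-* (c , α) q) ≡ term-* (c , deg α ∷ []) (push q)
    push-term []            = refl
    push-term ((d , β) ∷ q) =
      cong₂ _∷_ (cong (λ e → c ℚ.* d , e ∷ []) (dot-⊕ α β w)) (push-term q)

  -- Deduplication ensures that a sum over the fibre counts each exponent once.
  fiber : ℕ → List (Exponent m)
  fiber d = List.deduplicate _≟ᵉ_ (List.filter (λ α → deg α ℕₚ.≟ d) (box d))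

  fiber-unique : ∀ d → Unique (fiber d)
  fiber-unique d = UniqueDec.deduplicate-! _≟ᵉ_ _

  ∈-fiber⁺ : ∀ α → α ∈ₗ fiber (deg α)
  ∈-fiber⁺ α = ∈-deduplicate⁺ _≟ᵉ_
    (∈-filter⁺ (λ β → deg β ℕₚ.≟ deg α) (∈-box w w>0 α ℕₚ.≤-refl) refl)

  ∈-fiber⁻ : ∀ {d α} → α ∈ₗ fiber d → deg α ≡ d
  ∈-fiber⁻ {d} α∈ =
    proj₂ (∈-filter⁻ (λ β → deg β ℕₚ.≟ d) {xs = box d} (∈-deduplicate⁻ _≟ᵉ_ _ α∈))

  -- `push` acts on lists of terms, whereas the right-hand side depends only on the coefficients of
  -- p; this is what makes `push` respect `_≈_`.
  coeff-push : ∀ p d → coeff (push p) (d ∷ []) ≡ sumOver (fiber d) (coeff p)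
  coeff-push []            d = sym (sumOver-0 (fiber d) (λ _ → 0ℚ) λ _ _ → refl)
  coeff-push ((c , β) ∷ p) d = begin
    coeff (push ((c , β) ∷ p)) (d ∷ [])
      ≡⟨ coeff-++ (push ((c , β) ∷ [])) (push p) (d ∷ []) ⟩
    coeff (push ((c , β) ∷ [])) (d ∷ []) ℚ.+ coeff (push p) (d ∷ [])
      ≡⟨ cong₂ ℚ._+_ (leading (deg β ℕₚ.≟ d)) (coeff-push p d) ⟩
    sumOver (fiber d) (coeff ((c , β) ∷ [])) ℚ.+ sumOver (fiber d) (coeff p)
      ≡⟨ sumOver-+ (fiber d) (coeff ((c , β) ∷ [])) (coeff p) ⟨
    sumOver (fiber d) (λ α → coeff ((c , β) ∷ []) α ℚ.+ coeff p α)
      ≡⟨ sumOver-cong (fiber d) (λ α → coeff-++ ((c , β) ∷ []) p α) ⟨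
    sumOver (fiber d) (coeff ((c , β) ∷ p)) ∎
    where
    open ≡-Reasoning

    leading : Dec (deg β ≡ d) →
              coeff (push ((c , β) ∷ [])) (d ∷ []) ≡ sumOver (fiber d) (coeff ((c , β) ∷ []))
    leading (yes refl) = trans (coeff-∷-≡ c (d ∷ []) [])
      (sym (trans
        (sumOver-point (coeff ((c , β) ∷ [])) (fiber-unique d) (∈-fiber⁺ β)
          (λ α _ α≢β → coeff-∷-≢ c [] (≢-sym α≢β)))
        (coeff-∷-≡ c β [])))
    leading (no deg≢) = trans
      (coeff-∷-≢ c {deg β ∷ []} {d ∷ []} [] (deg≢ ∘ Vecₚ.∷-injectiveˡ))
      (sym (sumOver-0 (fiber d) (coeff ((c , β) ∷ [])) λ α α∈ →
        coeff-∷-≢ c {β} {α} [] λ { refl → deg≢ (∈-fiber⁻ α∈) }))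

  push-resp-≈ : ∀ f g → f ≈ g → push f ≈ push g
  push-resp-≈ f g f≈g (d ∷ []) = trans (coeff-push f d)
    (trans (sumOver-cong (fiber d) f≈g) (sym (coeff-push g d)))

  open Ideal m

  push-ideal : ∀ {gs : Vec (Poly m) r} → (∀ i → push (lookup gs i) ≈ []) →
               ∀ f → f ∈ ⟨ gs ⟩ → push f ≈ []
  push-ideal {r} {gs} gs↦0 f (hs , f≈) α =
    trans (push-resp-≈ f (combination hs gs) f≈ α) (combination↦0 hs gs gs↦0 α)
    where
    combination↦0 : ∀ {r} (hs gs : Vec (Poly m) r) → (∀ i → push (lookup gs i) ≈ []) →
                    push (combination hs gs) ≈ []
    combination↦0 []       []       gs↦0 α = refl
    combination↦0 (h ∷ hs) (g ∷ gs) gs↦0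
      rewrite push-++ (h *ᵖ g) (combination hs gs) | push-* h g =
      ++-≈[] (push h *ᵖ push g) _ (*ᵖ-≈[] (push h) (push g) (gs↦0 zero))
        (combination↦0 hs gs (gs↦0 ∘ suc))

  push-binomial : ∀ {α β} → deg α ≡ deg β → push (binomial α β) ≈ []
  push-binomial {α} {β} eq rewrite eq = binomial-self (deg β ∷ [])

  -- Coefficients in a fixed degree add up to zero, so none of them is alone.
  kernel-companion : ∀ f {α} → push f ≈ [] → coeff f α ≢ 0ℚ →
                     ∃[ β ] β ≢ α × deg β ≡ deg α × coeff f β ≢ 0ℚ
  kernel-companion f {α} f↦0 α∈supp
    with Any.any? (λ β → ¬? (β ≟ᵉ α) ×-dec ¬? (coeff f β ℚ.≟ 0ℚ)) (fiber (deg α))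
  ... | yes found with find found
  ...   | β , β∈ , β≢α , β∈supp = β , β≢α , ∈-fiber⁻ β∈ , β∈supp
  kernel-companion f {α} f↦0 α∈supp | no none = contradiction
    (trans (sym (sumOver-point (coeff f) (fiber-unique (deg α)) (∈-fiber⁺ α) λ β β∈ β≢α →
        decidable-stable (coeff f β ℚ.≟ 0ℚ) λ β∈supp →
          none (lose β∈ (β≢α , β∈supp))))
      (trans (sym (coeff-push f (deg α))) (f↦0 (deg α ∷ []))))
    α∈supp

-- Gröbner bases of toric ideals

lookup-injective : ∀ {A : Set} {xs : List A} → Unique xs → ∀ i j →
                   List.lookup xs i ≡ List.lookup xs j → i ≡ j
lookup-injective (_ ∷ _)    zero    zero    _  = refl
lookup-injective (x∉ ∷ _)   zero    (suc j) eq = contradiction eq (All.lookup x∉ (∈-lookup j))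
lookup-injective (x∉ ∷ _)   (suc i) zero    eq = contradiction (sym eq) (All.lookup x∉ (∈-lookup i))
lookup-injective (_ ∷ xs!)  (suc i) (suc j) eq = cong suc (lookup-injective xs! i j eq)

module MonomialOrdering {_≺_ : Rel (Exponent m) 0ℓ}
  (≺-isMonomialOrdering : IsMonomialOrdering _≺_) where

  open IsMonomialOrdering ≺-isMonomialOrdering public
  open IsStrictTotalOrder isStrictTotalOrder public
    using (compare; irrefl; asym; _<?_) renaming (trans to ≺-trans)

  ≺-cancelʳ : ∀ γ {α β} → (α ⊕ γ) ≺ (β ⊕ γ) → α ≺ β
  ≺-cancelʳ γ {α} {β} αγ≺βγ with compare α β
  ... | tri< α≺β _    _   = α≺β
  ... | tri≈ _   refl _   = contradiction αγ≺βγ (irrefl refl)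
  ... | tri> _   _    β≺α = contradiction αγ≺βγ (asym (compatible γ β≺α))

  IsExp-unique : ∀ g {α β} → IsExp _≺_ g α → IsExp _≺_ g β → α ≡ β
  IsExp-unique g {α} {β} (α∈ , ≼α) (β∈ , ≼β) with ≼α β β∈ | ≼β α α∈
  ... | inj₂ β≡α | _        = sym β≡α
  ... | inj₁ _   | inj₂ α≡β = α≡β
  ... | inj₁ β≺α | inj₁ α≺β = contradiction α≺β (asym β≺α)

  IsExp-monomial : ∀ α → IsExp _≺_ (monomial α) α
  IsExp-monomial α =
    (λ eq → contradiction (trans (sym (coeff-monomial α)) eq) λ ()) ,
    λ β β∈supp → inj₂ (monomial-support β∈supp)

  coeff-binomial-≺ : ∀ {α β} → β ≺ α → coeff (binomial α β) α ≡ 1ℚ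
  coeff-binomial-≺ β≺α = coeff-binomial λ β≡α → irrefl β≡α β≺α

  IsExp-binomial : ∀ {α β} → β ≺ α → IsExp _≺_ (binomial α β) α
  IsExp-binomial {α} {β} β≺α =
    (λ eq → contradiction (trans (sym (coeff-binomial-≺ β≺α)) eq) λ ()) , below
    where
    below : ∀ γ → coeff (binomial α β) γ ≢ 0ℚ → γ ≺ α ⊎ γ ≡ α
    below γ γ∈supp with binomial-support {α = α} {β} γ∈supp
    ... | inj₁ γ≡α  = inj₂ γ≡α
    ... | inj₂ refl = inj₁ β≺α

-- Reducible and standard monomials

module Toric (w : Vec ℕ m) (w>0 : PositiveWeight w)
  {_≺_ : Rel (Exponent m) 0ℓ} (≺-isMonomialOrdering : IsMonomialOrdering _≺_) where

  open Pushforward w w>0 public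
  open MonomialOrdering ≺-isMonomialOrdering public
  open Ideal m

  -- Membership in E(I), expressed without a basis: see `E⇒reducible` and `reducible⇒E`.
  Reducible : Pred (Exponent m) 0ℓ
  Reducible α = ∃[ β ] β ≺ α × deg β ≡ deg α

  reducible? : Decidable Reducible
  reducible? α = ∃-bounded? w w>0 (deg α) (λ _ (_ , eq) → ℕₚ.≤-reflexive eq)
    (λ β → (β <? α) ×-dec (deg β ℕₚ.≟ deg α))

  reducible-⊕ : ∀ {α} δ → Reducible α → Reducible (α ⊕ δ)
  reducible-⊕ {α} δ (β , β≺α , eq) = β ⊕ δ , compatible δ β≺α ,
    trans (dot-⊕ β δ w) (trans (cong (_+ deg δ) eq) (sym (dot-⊕ α δ w)))

  reducible-∣ : ∀ {α β} → α ∣ β → Reducible α → Reducible β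
  reducible-∣ (δ , refl) = reducible-⊕ δ

  standard-unique : ∀ {α β} → ¬ Reducible α → ¬ Reducible β → deg α ≡ deg β → α ≡ β
  standard-unique {α} {β} α-std β-std eq with compare α β
  ... | tri< α≺β _   _   = contradiction (α , α≺β , eq) β-std
  ... | tri≈ _   α≡β _   = α≡β
  ... | tri> _   _   β≺α = contradiction (β , β≺α , sym eq) α-std

  reduce : ∀ α → ∃[ β ] ¬ Reducible β × deg β ≡ deg α × (β ≺ α ⊎ β ≡ α)
  reduce α = go α (wellFounded α)
    where
    go : ∀ α → Acc _≺_ α → ∃[ β ] ¬ Reducible β × deg β ≡ deg α × (β ≺ α ⊎ β ≡ α)
    go α (acc rec) with reducible? α
    ... | no α-std = α , α-std , refl , inj₂ refl
    ... | yes (β , β≺α , eq) with go β (rec β≺α)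
    ...   | γ , γ-std , eq′ , inj₁ γ≺β  = γ , γ-std , trans eq′ eq , inj₁ (≺-trans γ≺β β≺α)
    ...   | γ , γ-std , eq′ , inj₂ refl = γ , γ-std , trans eq′ eq , inj₁ β≺α

  nf : Exponent m → Exponent m
  nf α = proj₁ (reduce α)

  nf-standard : ∀ α → ¬ Reducible (nf α)
  nf-standard α = proj₁ (proj₂ (reduce α))

  deg-nf : ∀ α → deg (nf α) ≡ deg α
  deg-nf α = proj₁ (proj₂ (proj₂ (reduce α)))

  nf-≺ : ∀ {α} → Reducible α → nf α ≺ α
  nf-≺ {α} α-red with proj₂ (proj₂ (proj₂ (reduce α)))
  ... | inj₁ nf≺α = nf≺α
  ... | inj₂ nf≡α = contradiction (subst Reducible (sym nf≡α) α-red) (nf-standard α)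

  -- These will be the leading exponents of the reduced Gröbner basis.
  MinimalReducible : Pred (Exponent m) 0ℓ
  MinimalReducible ε = Reducible ε × (∀ β → Reducible β → β ∣ ε → β ≡ ε)

  deg-∣ : ∀ {β α} → β ∣ α → deg β ≤ deg α
  deg-∣ {β} (δ , refl) rewrite dot-⊕ β δ w = ℕₚ.m≤m+n (deg β) (deg δ)

  deg-∣-< : ∀ {β α} → β ∣ α → β ≢ α → deg β < deg α
  deg-∣-< {β} (δ , refl) β≢ = ℕₚ.≤∧≢⇒< {deg β} (deg-∣ {β} (δ , refl)) λ eq →
    β≢ (sym (trans (cong (β ⊕_) (deg≡0⇒𝟎 w w>0 δ
      (ℕₚ.+-cancelˡ-≡ (deg β) (deg δ) 0
        (trans (sym (dot-⊕ β δ w)) (trans (sym eq) (sym (ℕₚ.+-identityʳ (deg β))))))))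
      (⊕-identityʳ β)))

  ProperDivisor : Exponent m → Pred (Exponent m) 0ℓ
  ProperDivisor ε β = Reducible β × β ∣ ε × β ≢ ε

  properDivisor? : ∀ ε → Dec (∃[ β ] ProperDivisor ε β)
  properDivisor? ε = ∃-bounded? w w>0 (deg ε) (λ _ (_ , β∣ε , _) → deg-∣ β∣ε)
    (λ β → reducible? β ×-dec (β ∣? ε) ×-dec ¬? (β ≟ᵉ ε))

  minimal : ∀ {ε} → ¬ (∃[ β ] ProperDivisor ε β) → ∀ β → Reducible β → β ∣ ε → β ≡ ε
  minimal {ε} none β β-red β∣ε =
    decidable-stable (β ≟ᵉ ε) λ β≢ε → none (β , β-red , β∣ε , β≢ε)

  minimalReducible? : Decidable MinimalReducible
  minimalReducible? ε = reducible? ε ×-dec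
    map′ minimal (λ min (β , β-red , β∣ε , β≢ε) → β≢ε (min β β-red β∣ε))
      (¬? (properDivisor? ε))

  minimalReducible-∣ : ∀ α → Reducible α → ∃[ ε ] MinimalReducible ε × ε ∣ α
  minimalReducible-∣ α = go α (<-wellFounded (deg α))
    where
    go : ∀ α → Acc _<_ (deg α) → Reducible α → ∃[ ε ] MinimalReducible ε × ε ∣ α
    go α (acc rec) α-red with properDivisor? α
    ... | no none = α , (α-red , minimal none) , 𝟎 , sym (⊕-identityʳ α)
    ... | yes (β , β-red , β∣α , β≢α) with go β (rec (deg-∣-< β∣α β≢α)) β-red
    ...   | ε , ε-min , δ , refl with β∣α
    ...     | δ′ , refl = ε , ε-min , δ ⊕ δ′ , ⊕-assoc ε δ δ′

  -- A variable common to ε and β could be cancelled from both, leaving a reducible proper divisor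
  -- of ε.
  minimalReducible-disjoint : ∀ {ε β} → MinimalReducible ε → β ≺ ε → deg β ≡ deg ε →
                              ∀ i → lookup ε i ≢ 0 → lookup β i ≡ 0
  minimalReducible-disjoint {ε} {β} (_ , ε-min) β≺ε eq i εᵢ≢0 =
    decidable-stable (lookup β i ℕₚ.≟ 0) λ βᵢ≢0 → clash
      (power-∣ i 1 ε (ℕₚ.n≢0⇒n>0 εᵢ≢0)) (power-∣ i 1 β (ℕₚ.n≢0⇒n>0 βᵢ≢0)) ε-min β≺ε eq
    where
    u = unit i

    clash : ∀ {ε β} → u ∣ ε → u ∣ β → (∀ β → Reducible β → β ∣ ε → β ≡ ε) →
            β ≺ ε → deg β ≡ deg ε → ⊥
    clash (ε′ , refl) (β′ , refl) ε-min β≺ε eq = ℕₚ.<⇒≢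
      -- Minimality identifies ε′ with u ⊕ ε′, although the latter has larger degree.
      (ℕₚ.m<n+m (deg ε′) (ℕₚ.n≢0⇒n>0 u-deg≢0))
      (trans (cong deg (ε-min ε′ (β′ , β′≺ε′ , eq′) (u , ⊕-comm u ε′))) (dot-⊕ u ε′ w))
      where
      u-deg≢0 : deg u ≢ 0
      u-deg≢0 z = ≢-nonZero⁻¹ (lookup w i) {{w>0 i}} (trans (sym (dot-unit i w)) z)

      β′≺ε′ : β′ ≺ ε′
      β′≺ε′ = ≺-cancelʳ u (subst₂ _≺_ (⊕-comm u β′) (⊕-comm u ε′) β≺ε)

      eq′ : deg β′ ≡ deg ε′
      eq′ = ℕₚ.+-cancelˡ-≡ (deg u) _ _
        (trans (sym (dot-⊕ u β′ w)) (trans eq (dot-⊕ u ε′ w)))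

  -- If all variables but one have a power among the reducible monomials, the
  -- remaining variable l occurs in only one of ε and nf ε; the other of the two
  -- has all its exponents bounded, and the same degree.
  deg-minimalReducible : ∀ l c → (∀ j → j ≢ l → Reducible (power j c)) →
                         ∀ {ε} → MinimalReducible ε → deg ε ≤ c * Vec.sum w
  deg-minimalReducible l c powers {ε} ε-min@(ε-red , min) with lookup ε l ℕₚ.≟ 0
  ... | yes εₗ≡0 = dot≤*sum c ε w ε≤c
    where
    ε≤c : ∀ j → lookup ε j ≤ c
    ε≤c j with j Fin.≟ l
    ... | yes refl = subst (_≤ c) (sym εₗ≡0) z≤n
    -- If the j-th exponent exceeded c, the reducible `power j c` would divide ε, hence equal it by
    -- minimality, and the exponent would be c after all.
    ... | no j≢l = ℕₚ.≮⇒≥ λ c<εⱼ → ℕₚ.<⇒≢ c<εⱼ (trans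
      (sym (Vecₚ.lookup∘update j 𝟎 c))
      (cong (λ α → lookup α j)
        (min (power j c) (powers j j≢l) (power-∣ j c ε (ℕₚ.<⇒≤ c<εⱼ)))))
  ... | no εₗ≢0 = subst (_≤ c * Vec.sum w) (deg-nf ε) (dot≤*sum c (nf ε) w nf≤c)
    where
    nf≤c : ∀ j → lookup (nf ε) j ≤ c
    nf≤c j with j Fin.≟ l
    ... | yes refl = subst (_≤ c)
      (sym (minimalReducible-disjoint ε-min (nf-≺ ε-red) (deg-nf ε) l εₗ≢0)) z≤n
    ... | no j≢l = ℕₚ.≮⇒≥ λ c<nfⱼ → nf-standard ε
      (reducible-∣ (power-∣ j c (nf ε) (ℕₚ.<⇒≤ c<nfⱼ)) (powers j j≢l))

  module _ (D : ℕ) (bound : ∀ {ε} → MinimalReducible ε → deg ε ≤ D) where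

    minimalReducibles : List (Exponent m)
    minimalReducibles = List.deduplicate _≟ᵉ_ (List.filter minimalReducible? (box D))

    minimalReducibles-unique : Unique minimalReducibles
    minimalReducibles-unique = UniqueDec.deduplicate-! _≟ᵉ_ _

    ∈-minimalReducibles⁻ : ∀ {ε} → ε ∈ₗ minimalReducibles → MinimalReducible ε
    ∈-minimalReducibles⁻ ε∈ = proj₂ (∈-filter⁻ minimalReducible? {xs = box D}
      (∈-deduplicate⁻ _≟ᵉ_ _ ε∈))

    ∈-minimalReducibles⁺ : ∀ {ε} → MinimalReducible ε → ε ∈ₗ minimalReducibles
    ∈-minimalReducibles⁺ {ε} ε-min = ∈-deduplicate⁺ _≟ᵉ_
      (∈-filter⁺ minimalReducible? (∈-box w w>0 ε (bound ε-min)) ε-min)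

  -- Gröbner bases of the ideal of a grading

  module GröbnerBasis
    {I : Pred (Poly m) 0ℓ}
    (I↦0         : ∀ f → f ∈ I → push f ≈ [])
    (binomial-∈I : ∀ α β → deg α ≡ deg β → binomial α β ∈ I)
    where

    -- The leading monomial cannot be alone in its degree, and any companion in f is smaller than
    -- it.
    exp-reducible : ∀ {f α} → f ∈ I → IsExp _≺_ f α → Reducible α
    exp-reducible {f} {α} f∈I (α∈ , ≼α) with kernel-companion f (I↦0 f f∈I) α∈
    ... | β , β≢α , eq , β∈ with ≼α β β∈
    ...   | inj₁ β≺α = β , β≺α , eq
    ...   | inj₂ β≡α = contradiction β≡α β≢α

    module _ {B : Vec (Poly m) r} (B-reduced : IsReducedGröbnerBasis _≺_ I B) where
      open IsReducedGröbnerBasis B-reduced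

      E⇒reducible : ∀ {α} → α ∈ E _≺_ B → Reducible α
      E⇒reducible (i , ε , ε-exp , δ , refl) =
        reducible-⊕ δ (exp-reducible (contained i) ε-exp)

      reducible⇒E : ∀ {α} → Reducible α → α ∈ E _≺_ B
      reducible⇒E {α} (β , β≺α , eq) =
        gröbner (binomial α β) α (binomial-∈I α β (sym eq)) (IsExp-binomial β≺α)

      normalForm-standard : ∀ f p {γ} → IsNormalForm _≺_ B f p → coeff p γ ≢ 0ℚ →
                            ¬ Reducible γ
      normalForm-standard f p (_ , irred) γ∈ γ-red = irred _ γ∈ (reducible⇒E γ-red)

      -- The difference monomial α - p has no monomial alone in its degree,
      -- whereas p has at most one monomial in each degree.
      deg-normalForm : ∀ α p {γ} → IsNormalForm _≺_ B (monomial α) p → coeff p γ ≢ 0ℚ →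
                       deg γ ≡ deg α
      deg-normalForm α p {γ} p-nf@(α-p∈ , _) γ∈ =
        decidable-stable (deg γ ℕₚ.≟ deg α) λ deg≢ →
          let f = monomial α -ᵖ p
              -- In this degree, assumed different from that of α, f agrees with -p, so a companion
              -- of γ in f is a monomial of p.
              coeff-f : ∀ δ → deg δ ≡ deg γ → coeff f δ ≡ ℚ.- coeff p δ
              coeff-f δ eq = trans
                (coeff-∷-≢ 1ℚ {α} {δ} (-ᵖ p) λ { refl → deg≢ (sym eq) })
                (coeff-neg p δ)
              β , β≢γ , eq , β∈f = kernel-companion f
                (push-ideal (λ i → I↦0 _ (contained i)) f α-p∈)
                (λ z → γ∈ (ℚₚ.neg-injective (trans (sym (coeff-f γ refl)) z)))
              β∈ = λ z → β∈f (trans (coeff-f β eq) (cong ℚ.-_ z))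
          in β≢γ (standard-unique (normalForm-standard (monomial α) p p-nf β∈)
                                  (normalForm-standard (monomial α) p p-nf γ∈) eq)

    module _ {leads : List (Exponent m)} (leads-unique : Unique leads)
      (leads⁻ : ∀ {ε} → ε ∈ₗ leads → MinimalReducible ε)
      (leads⁺ : ∀ {ε} → MinimalReducible ε → ε ∈ₗ leads) where

      lead : Fin (List.length leads) → Exponent m
      lead = List.lookup leads

      lead-minimal : ∀ i → MinimalReducible (lead i)
      lead-minimal i = leads⁻ (∈-lookup i)

      lead-surjective : ∀ {ε} → MinimalReducible ε → ∃[ i ] ε ≡ lead i
      lead-surjective ε-min = Any.index (leads⁺ ε-min) , lookup-index (leads⁺ ε-min)

      -- Taking normal forms as the tails is what makes the basis reduced and not merely minimal.
      basis : Vec (Poly m) (List.length leads)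
      basis = Vec.tabulate λ i → binomial (lead i) (nf (lead i))

      lookup-basis : ∀ i → lookup basis i ≡ binomial (lead i) (nf (lead i))
      lookup-basis = Vecₚ.lookup∘tabulate _

      basis-exp : ∀ i → IsExp _≺_ (lookup basis i) (lead i)
      basis-exp i rewrite lookup-basis i = IsExp-binomial (nf-≺ (proj₁ (lead-minimal i)))

      E-basis : ∀ {α} → Reducible α → α ∈ E _≺_ basis
      E-basis {α} α-red with minimalReducible-∣ α α-red
      ... | ε , ε-min , ε∣α with lead-surjective ε-min
      ...   | i , refl = i , lead i , basis-exp i , ε∣α

      ExpCone-basis : ∀ {α} j → α ∈ ExpCone _≺_ (lookup basis j) → lead j ∣ α
      ExpCone-basis j (ε , ε-exp , ε∣α) with IsExp-unique (lookup basis j) ε-exp (basis-exp j)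
      ... | refl = ε∣α

      basis-reduced : IsReducedGröbnerBasis _≺_ I basis
      basis-reduced = record
        { contained = λ i → subst (_∈ I) (sym (lookup-basis i))
            (binomial-∈I (lead i) (nf (lead i)) (sym (deg-nf (lead i))))
        ; gröbner = λ f α f∈I α-exp → E-basis (exp-reducible f∈I α-exp)
        ; monic = λ i → lead i , basis-exp i , trans
            (cong (λ g → coeff g (lead i)) (lookup-basis i))
            (coeff-binomial-≺ (nf-≺ (proj₁ (lead-minimal i))))
        ; reduced = reduced
        }
        where
        reduced : ∀ i j → i ≢ j → ∀ α → coeff (lookup basis i) α ≢ 0ℚ →
                  α ∉ ExpCone _≺_ (lookup basis j)
        reduced i j i≢j α α∈ α∈cone
          with binomial-support {α = lead i} {nf (lead i)}
                 (subst (λ g → coeff g α ≢ 0ℚ) (lookup-basis i) α∈)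
        -- For the leading term, minimality of `lead i` forces `lead j` to equal it; the tail below
        -- is standard, so no lead divides it.
        ... | inj₁ refl = i≢j (lookup-injective leads-unique i j
          (sym (proj₂ (lead-minimal i) _ (proj₁ (lead-minimal j)) (ExpCone-basis j α∈cone))))
        ... | inj₂ refl with ExpCone-basis j α∈cone
        ...   | δ , eq = nf-standard (lead i)
          (subst Reducible (sym eq) (reducible-⊕ δ (proj₁ (lead-minimal j))))

      -- Division by the basis: a reducible α = ε ⊕ δ is rewritten to the smaller `nf` ε ⊕ δ. Both
      -- have the same normal form, since a standard monomial is determined by its degree.
      reduction : ∀ α → binomial α (nf α) ∈ ⟨ basis ⟩
      reduction α = go α (wellFounded α)
        where
        go : ∀ α → Acc _≺_ α → binomial α (nf α) ∈ ⟨ basis ⟩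
        go α (acc rec) with reducible? α
        ... | no α-std = subst (λ β → binomial α β ∈ ⟨ basis ⟩)
          (standard-unique α-std (nf-standard α) (sym (deg-nf α))) (binomial-refl α)
        ... | yes α-red with minimalReducible-∣ α α-red
        ...   | ε , ε-min , δ , refl with lead-surjective ε-min
        ...     | i , refl = binomial-trans (lead i ⊕ δ) β (nf (lead i ⊕ δ))
          (binomial-multiple i (lookup-basis i) δ)
          (subst (λ γ → binomial β γ ∈ ⟨ basis ⟩) nf-β (go β (rec β≺α)))
          where
          β = nf (lead i) ⊕ δ

          β≺α : β ≺ (lead i ⊕ δ)
          β≺α = compatible δ (nf-≺ (proj₁ ε-min))

          nf-β : nf β ≡ nf (lead i ⊕ δ)
          nf-β = standard-unique (nf-standard β) (nf-standard (lead i ⊕ δ)) (begin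
            deg (nf β)                  ≡⟨ deg-nf β ⟩
            deg β                       ≡⟨ dot-⊕ (nf (lead i)) δ w ⟩
            deg (nf (lead i)) + deg δ   ≡⟨ cong (_+ deg δ) (deg-nf (lead i)) ⟩
            deg (lead i) + deg δ        ≡⟨ dot-⊕ (lead i) δ w ⟨
            deg (lead i ⊕ δ)            ≡⟨ deg-nf (lead i ⊕ δ) ⟨
            deg (nf (lead i ⊕ δ))       ∎)
            where open ≡-Reasoning

      nf-isNormalForm : ∀ α → IsNormalForm _≺_ basis (monomial α) (monomial (nf α))
      nf-isNormalForm α = reduction α , λ β β∈ β∈E →
        nf-standard α (subst Reducible (monomial-support β∈) (E⇒reducible basis-reduced β∈E))

-- Construction of Apéry orderings

module _ {A : Set} where

  -- Pullbacks and lexicographic products are total over a derived equality, whereas a monomial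
  -- ordering has to be total over `_≡_`.
  isStrictTotalOrder-≡ : ∀ {_≈_ _<_ : Rel A 0ℓ} → (∀ {x y} → x ≈ y → x ≡ y) →
                         IsStrictTotalOrder _≈_ _<_ → IsStrictTotalOrder _≡_ _<_
  isStrictTotalOrder-≡ {_≈_} {_<_} ≈⇒≡ sto = record
    { isStrictPartialOrder = record
      { isEquivalence = isEquivalence
      ; irrefl = λ { refl → irrefl S.refl }
      ; trans = S.trans
      ; <-resp-≈ = (λ { refl → id }) , (λ { refl → id })
      }
    ; compare = compare′
    }
    where
    module S where
      open IsStrictTotalOrder sto public
      open IsStrictTotalOrder.Eq sto public using (refl; reflexive)
    open S using (irrefl)
    compare′ : ∀ x y → _
    compare′ x y with S.compare x y
    ... | tri< x<y x≉y x≯y = tri< x<y (x≉y ∘ S.reflexive) x≯y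
    ... | tri≈ x≮y x≈y x≯y = tri≈ x≮y (≈⇒≡ x≈y) x≯y
    ... | tri> x≮y x≉y x>y = tri> x≮y (x≉y ∘ S.reflexive) x>y

  on-isStrictTotalOrder : ∀ {B : Set} {_<_ : Rel B 0ℓ} (f : A → B) →
    (∀ {x y} → f x ≡ f y → x ≡ y) →
    IsStrictTotalOrder _≡_ _<_ → IsStrictTotalOrder _≡_ (_<_ on f)
  on-isStrictTotalOrder f inj sto = isStrictTotalOrder-≡ inj (On.isStrictTotalOrder f sto)

×-Lex-isStrictTotalOrder : ∀ {A B : Set} {_<₁_ : Rel A 0ℓ} {_<₂_ : Rel B 0ℓ} →
  IsStrictTotalOrder _≡_ _<₁_ → IsStrictTotalOrder _≡_ _<₂_ →
  IsStrictTotalOrder _≡_ (×-Lex _≡_ _<₁_ _<₂_)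
×-Lex-isStrictTotalOrder sto₁ sto₂ =
  isStrictTotalOrder-≡ (λ (eq₁ , eq₂) → cong₂ _,_ eq₁ eq₂) (×-isStrictTotalOrder sto₁ sto₂)

infix 4 _<ˡᵉˣ_
_<ˡᵉˣ_ : Rel (Exponent m) 0ℓ
_<ˡᵉˣ_ {zero}  _ _ = ⊥
_<ˡᵉˣ_ {suc m}     = ×-Lex _≡_ _<_ _<ˡᵉˣ_ on Vec.uncons

<ˡᵉˣ-isMonomialOrdering : IsMonomialOrdering (_<ˡᵉˣ_ {m})
<ˡᵉˣ-isMonomialOrdering {zero} = record
  { isStrictTotalOrder = record
    { isStrictPartialOrder = record
      { isEquivalence = isEquivalence
      ; irrefl = λ _ ()
      ; trans = λ ()
      ; <-resp-≈ = (λ _ ()) , (λ _ ())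
      }
    ; compare = λ { [] [] → tri≈ (λ ()) refl (λ ()) }
    }
  ; compatible = λ _ ()
  ; wellFounded = λ _ → acc λ ()
  }
<ˡᵉˣ-isMonomialOrdering {suc m} = record
  { isStrictTotalOrder = on-isStrictTotalOrder Vec.uncons
      (λ { {_ ∷ _} {_ ∷ _} refl → refl })
      (×-Lex-isStrictTotalOrder ℕₚ.<-isStrictTotalOrder (isStrictTotalOrder ih))
  ; compatible = λ { {_ ∷ _} {_ ∷ _} (c ∷ γ) →
      Sum.map (ℕₚ.+-monoˡ-< c) (Prod.map (cong (_+ c)) (compatible ih γ)) }
  ; wellFounded = On.wellFounded Vec.uncons (×-wellFounded <-wellFounded (wellFounded ih))
  }
  where
  ih = <ˡᵉˣ-isMonomialOrdering {m}
  open IsMonomialOrdering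

-- The lexicographic tie-break makes the order total and well-founded even when b has zero entries,
-- as it may in `preferring`.
weightLex : Vec ℕ m → Rel (Exponent m) 0ℓ
weightLex b = ×-Lex _≡_ _<_ _<ˡᵉˣ_ on λ γ → dot γ b , γ

weightLex-isMonomialOrdering : (b : Vec ℕ m) → IsMonomialOrdering (weightLex b)
weightLex-isMonomialOrdering b = record
  { isStrictTotalOrder = on-isStrictTotalOrder (λ γ → dot γ b , γ) (cong proj₂)
      (×-Lex-isStrictTotalOrder ℕₚ.<-isStrictTotalOrder isStrictTotalOrder)
  ; compatible = compatible′
  ; wellFounded = On.wellFounded (λ γ → dot γ b , γ) (×-wellFounded <-wellFounded wellFounded)
  }
  where
  open IsMonomialOrdering <ˡᵉˣ-isMonomialOrdering

  compatible′ : ∀ {α β} γ → weightLex b α β → weightLex b (α ⊕ γ) (β ⊕ γ)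
  compatible′ {α} {β} γ rewrite dot-⊕ α γ b | dot-⊕ β γ b =
    Sum.map (ℕₚ.+-monoˡ-< (dot γ b)) (Prod.map (cong (_+ dot γ b)) (compatible γ))

-- Separating yₖ from the other variables

init-⊕ : (α β : Exponent (suc n)) → init (α ⊕ β) ≡ init α ⊕ init β
init-⊕ {zero}  (a ∷ []) (b ∷ []) = refl
init-⊕ {suc n} (a ∷ α)  (b ∷ β)  = cong (a + b ∷_) (init-⊕ α β)

last-⊕ : (α β : Exponent (suc n)) → last (α ⊕ β) ≡ last α + last β
last-⊕ {zero}  (a ∷ []) (b ∷ []) = refl
last-⊕ {suc n} (a ∷ α)  (b ∷ β)  = last-⊕ α β

init-∷ʳ-last : ∀ {A : Set} (xs : Vec A (suc n)) → xs ≡ init xs ∷ʳ last xs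
init-∷ʳ-last xs = proj₂ (proj₂ (Vec.initLast xs))

lookup-fromℕ : ∀ {A : Set} (xs : Vec A (suc n)) → lookup xs (Fin.fromℕ n) ≡ last xs
lookup-fromℕ {zero}  (x ∷ []) = refl
lookup-fromℕ {suc n} (x ∷ xs) = lookup-fromℕ xs

dot-init-last : (α a : Vec ℕ (suc n)) →
                dot α a ≡ dot (init α) (init a) + last α * last a
dot-init-last {zero}  (x ∷ []) (b ∷ []) = ℕₚ.+-identityʳ (x * b)
dot-init-last {suc n} (x ∷ α)  (b ∷ a)  =
  trans (cong (x * b +_) (dot-init-last α a)) (sym (ℕₚ.+-assoc (x * b) _ _))

dot-init : (α a : Vec ℕ (suc n)) → last α ≡ 0 → dot (init α) (init a) ≡ dot α a
dot-init α a eq = sym (trans (dot-init-last α a)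
  (trans (cong (λ z → dot (init α) (init a) + z * last a) eq) (ℕₚ.+-identityʳ _)))

-- Within one degree, a smaller weight with aᵢ erased therefore means a larger exponent of yᵢ.
dot-erase : ∀ (α a : Vec ℕ m) i → dot α a ≡ lookup α i * lookup a i + dot α (a [ i ]≔ 0)
dot-erase (x ∷ α) (b ∷ a) zero    =
  cong (λ z → x * b + (z + dot α a)) (sym (ℕₚ.*-zeroʳ x))
dot-erase (x ∷ α) (b ∷ a) (suc i) = trans (cong (x * b +_) (dot-erase α a i))
  (solve 3 (λ x y z → x :+ (y :+ z) := y :+ (x :+ z)) refl
    (x * b) (lookup α i * lookup a i) (dot α (a [ i ]≔ 0)))
  where open +-*-Solver

criteria-injective : (a : Vec ℕ (suc n)) → ∀ {α β} → criteria a α ≡ criteria a β → α ≡ β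
criteria-injective a {_ ∷ αs} {_ ∷ βs} eq = cong₂ _∷_ (cong proj₁ eq)
  (trans (init-∷ʳ-last αs)
    (trans (cong₂ _∷ʳ_ (cong (proj₁ ∘ proj₂ ∘ proj₂) eq) (cong (proj₂ ∘ proj₂ ∘ proj₂) eq))
      (sym (init-∷ʳ-last βs))))

AperyLex-isMonomialOrdering : (a : Vec ℕ (suc n)) {_⊏_ : Rel (Exponent n) 0ℓ} →
  IsMonomialOrdering _⊏_ → IsMonomialOrdering (AperyLex a _⊏_)
AperyLex-isMonomialOrdering a {_⊏_} ⊏-mo = record
  { isStrictTotalOrder = on-isStrictTotalOrder (criteria a) (criteria-injective a)
      (×-Lex-isStrictTotalOrder <-sto (×-Lex-isStrictTotalOrder <-sto
        (×-Lex-isStrictTotalOrder isStrictTotalOrder <-sto)))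
  ; compatible = λ {α} {β} → compatible′ α β
  ; wellFounded = On.wellFounded (criteria a)
      (×-wellFounded <-wellFounded (×-wellFounded <-wellFounded
        (×-wellFounded wellFounded <-wellFounded)))
  }
  where
  open IsMonomialOrdering ⊏-mo
  <-sto = ℕₚ.<-isStrictTotalOrder

  compatible′ : ∀ α β γ → AperyLex a _⊏_ α β → AperyLex a _⊏_ (α ⊕ γ) (β ⊕ γ)
  compatible′ (_ ∷ α) (_ ∷ β) (c ∷ γ)
    rewrite init-⊕ α γ | init-⊕ β γ | last-⊕ α γ | last-⊕ β γ
          | dot-⊕ (init α) (init γ) (init a) | dot-⊕ (init β) (init γ) (init a) =
    Sum.map (ℕₚ.+-monoˡ-< c) (Prod.map (cong (_+ c))
      (Sum.map (ℕₚ.+-monoˡ-< (dot (init γ) (init a))) (Prod.map (cong (_+ dot (init γ) (init a)))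
        (Sum.map (compatible (init γ)) (Prod.map (cong (_⊕ init γ))
          (ℕₚ.+-monoˡ-< (last γ)))))))

aperyOrdering : (a : Vec ℕ (suc n)) {_⊏_ : Rel (Exponent n) 0ℓ} →
                IsMonomialOrdering _⊏_ → AperyOrdering a
aperyOrdering a {_⊏_} ⊏-mo = record
  { _≺_ = AperyLex a _⊏_
  ; isMonomialOrdering = AperyLex-isMonomialOrdering a ⊏-mo
  ; _⊏_ = _⊏_
  ; ⊏-isMonomialOrdering = ⊏-mo
  ; compares = λ _ _ → mk⇔ id id
  }

-- Among monomials free of yₖ and of equal weight, the smallest ones have the
-- largest exponent of yᵢ, since they have the least weight in the other variables.
preferring : (a : Vec ℕ (suc n)) → Fin (suc n) → AperyOrdering a
preferring a i = aperyOrdering a (weightLex-isMonomialOrdering (init (a [ i ]≔ 0)))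

-- Apéry sets

module Apéry (a : Vec ℕ (suc n)) (a>0 : PositiveWeight a) where

  S : Pred ℕ 0ℓ
  S = Generated a

  aₖ : ℕ
  aₖ = last a

  w : Vec ℕ (suc (suc n))
  w = 1 ∷ a

  w>0 : PositiveWeight w
  w>0 zero    = _
  w>0 (suc i) = a>0 i

  open Ideal (suc (suc n))
  open Pushforward w w>0

  deg-x : ∀ d → deg (d ∷ 𝟎) ≡ d
  deg-x d rewrite dot-𝟎 a | ℕₚ.*-identityʳ d = ℕₚ.+-identityʳ d

  lookup-generators : ∀ i → lookup (I-generators a) i ≡ binomial (0 ∷ unit i) (lookup a i ∷ 𝟎)
  lookup-generators = Vecₚ.lookup∘tabulate _

  I↦0 : ∀ f → f ∈ I⟨ a ⟩ → push f ≈ []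
  I↦0 = push-ideal λ i → subst (λ g → push g ≈ []) (sym (lookup-generators i))
    (push-binomial {0 ∷ unit i} {lookup a i ∷ 𝟎}
      (trans (dot-unit i a) (sym (deg-x (lookup a i)))))

  -- Each generator replaces one yᵢ by x^aᵢ. The exponent α₀ is quantified inside the induction
  -- because every replacement raises it.
  to-x : ∀ αs α₀ → binomial (α₀ ∷ αs) (α₀ + dot αs a ∷ 𝟎) ∈ I⟨ a ⟩
  to-x = exponent-induction _
    (λ α₀ → subst (λ e → binomial (α₀ ∷ 𝟎) (e ∷ 𝟎) ∈ I⟨ a ⟩)
      (sym (trans (cong (α₀ +_) (dot-𝟎 a)) (ℕₚ.+-identityʳ α₀))) (binomial-refl (α₀ ∷ 𝟎)))
    λ i αs ih α₀ → binomial-trans (α₀ ∷ unit i ⊕ αs) (lookup a i + α₀ ∷ αs)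
      (α₀ + dot (unit i ⊕ αs) a ∷ 𝟎)
      (subst (λ βs → binomial (α₀ ∷ unit i ⊕ αs) (lookup a i + α₀ ∷ βs) ∈ I⟨ a ⟩)
        (⊕-identityˡ αs)
        (binomial-multiple i (lookup-generators i) (α₀ ∷ αs)))
      (subst (λ e → binomial (lookup a i + α₀ ∷ αs) (e ∷ 𝟎) ∈ I⟨ a ⟩)
        (begin
          lookup a i + α₀ + dot αs a          ≡⟨ cong (_+ dot αs a) (ℕₚ.+-comm (lookup a i) α₀) ⟩
          α₀ + lookup a i + dot αs a          ≡⟨ ℕₚ.+-assoc α₀ (lookup a i) (dot αs a) ⟩
          α₀ + (lookup a i + dot αs a)        ≡⟨ cong (λ e → α₀ + (e + dot αs a)) (dot-unit i a) ⟨
          α₀ + (dot (unit i) a + dot αs a)    ≡⟨ cong (α₀ +_) (dot-⊕ (unit i) αs a) ⟨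
          α₀ + dot (unit i ⊕ αs) a            ∎)
        (ih (lookup a i + α₀)))
    where open ≡-Reasoning

  -- Both monomials are congruent to the same power of x.
  binomial-∈I : ∀ α β → deg α ≡ deg β → binomial α β ∈ I⟨ a ⟩
  binomial-∈I (α₀ ∷ αs) (β₀ ∷ βs) eq = binomial-trans (α₀ ∷ αs) (α₀ + dot αs a ∷ 𝟎) (β₀ ∷ βs)
    (to-x αs α₀)
    (binomial-sym (β₀ ∷ βs) (α₀ + dot αs a ∷ 𝟎)
      (subst (λ e → binomial (β₀ ∷ βs) (e ∷ 𝟎) ∈ I⟨ a ⟩) (sym eq′) (to-x βs β₀)))
    where
    eq′ : α₀ + dot αs a ≡ β₀ + dot βs a
    eq′ = subst₂ (λ x y → x + dot αs a ≡ y + dot βs a)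
      (ℕₚ.*-identityʳ α₀) (ℕₚ.*-identityʳ β₀) eq

  unit-last : dot (unit (Fin.fromℕ n)) a ≡ aₖ
  unit-last = trans (dot-unit (Fin.fromℕ n) a) (lookup-fromℕ a)

  -- Cancelling a factor yₖ would exhibit the degree minus aₖ as an element of S.
  Ap⇒last≡0 : ∀ βs → dot βs a ∈ Ap S aₖ → last βs ≡ 0
  Ap⇒last≡0 βs (_ , ∉S) = decidable-stable (last βs ℕₚ.≟ 0) λ last≢0 →
    let δ , βs≡ = power-∣ (Fin.fromℕ n) 1 βs
          (subst (1 ≤_) (sym (lookup-fromℕ βs)) (ℕₚ.n≢0⇒n>0 last≢0))
    in ∉S (dot δ a , (δ , refl) , (begin
      dot δ a + aₖ                              ≡⟨ ℕₚ.+-comm (dot δ a) aₖ ⟩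
      aₖ + dot δ a                              ≡⟨ cong (_+ dot δ a) unit-last ⟨
      dot (unit (Fin.fromℕ n)) a + dot δ a      ≡⟨ dot-⊕ (unit (Fin.fromℕ n)) δ a ⟨
      dot (unit (Fin.fromℕ n) ⊕ δ) a            ≡⟨ cong (λ αs → dot αs a) βs≡ ⟨
      dot βs a                                  ∎))
    where open ≡-Reasoning

  -- Standard monomials of an Apéry ordering

  module _ (O : AperyOrdering a) where

    open AperyOrdering O
    open Toric w w>0 isMonomialOrdering
      hiding (deg; push; push-ideal; push-binomial)
    open GröbnerBasis I↦0 binomial-∈I

    x-≺ : ∀ {α₀ β₀ αs βs} → α₀ < β₀ → (α₀ ∷ αs) ≺ (β₀ ∷ βs)
    x-≺ lt = Equivalence.from (compares _ _) (inj₁ lt)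

    -- At equal degree, more yₖ leaves less weight for y₁, ..., yₖ₋₁, so criterion (2) decides
    -- before criterion (4), which would say the opposite.
    last-≺ : ∀ {α₀ αs βs} → dot αs a ≡ dot βs a → last βs < last αs → (α₀ ∷ αs) ≺ (α₀ ∷ βs)
    last-≺ {α₀} {αs} {βs} eq lt = Equivalence.from (compares _ _) (inj₂ (refl , inj₁
      (ℕₚ.≰⇒> λ le → ℕₚ.<⇒≢
        (ℕₚ.+-mono-≤-< le (ℕₚ.*-monoˡ-< aₖ {{aₖ>0}} lt))
        (trans (sym (dot-init-last βs a)) (trans (sym eq) (dot-init-last αs a))))))
      where
      aₖ>0 : NonZero aₖ
      aₖ>0 = subst NonZero (lookup-fromℕ a) (a>0 (Fin.fromℕ n))

    -- The witnesses are yₖ for x^aₖ and yₖ^aᵢ for yᵢ^aₖ.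
    power-reducible : ∀ j → j ≢ Fin.fromℕ (suc n) → Reducible (power j aₖ)
    power-reducible zero _ =
      (0 ∷ unit (Fin.fromℕ n)) ,
      x-≺ (ℕₚ.n≢0⇒n>0 (≢-nonZero⁻¹ aₖ {{subst NonZero (lookup-fromℕ a) (a>0 _)}})) ,
      trans unit-last (sym (deg-x aₖ))
    power-reducible (suc i) i≢last =
      (0 ∷ power (Fin.fromℕ n) (lookup a i)) , last-≺ eq lt , eq
      where
      eq : dot (power (Fin.fromℕ n) (lookup a i)) a ≡ dot (power i aₖ) a
      eq rewrite dot-power (Fin.fromℕ n) (lookup a i) a | dot-power i aₖ a | lookup-fromℕ a =
        ℕₚ.*-comm (lookup a i) aₖ

      lt : last (power i aₖ) < last (power (Fin.fromℕ n) (lookup a i))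
      lt rewrite sym (lookup-fromℕ (power i aₖ))
               | sym (lookup-fromℕ (power (Fin.fromℕ n) (lookup a i)))
               | Vecₚ.lookup∘update′ {i = Fin.fromℕ n} {i} (λ eq → i≢last (cong suc (sym eq))) 𝟎 aₖ
               | Vecₚ.lookup-replicate (Fin.fromℕ n) 0
               | Vecₚ.lookup∘update (Fin.fromℕ n) 𝟎 (lookup a i) =
        ℕₚ.n≢0⇒n>0 (≢-nonZero⁻¹ (lookup a i) {{a>0 i}})

    standard⇒Ap : ∀ {αs} → ¬ Reducible (0 ∷ αs) → last αs ≡ 0 → dot αs a ∈ Ap S aₖ
    standard⇒Ap {αs} std last≡0 = (αs , refl) , λ { (_ , (l , refl) , eq) →
      let v   = unit (Fin.fromℕ n)
          eq′ = trans (dot-⊕ l v a) (trans (cong (dot l a +_) unit-last) eq)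
      in std (0 ∷ l ⊕ v , last-≺ eq′ (positive l) , eq′) }
      where
      positive : ∀ l → last αs < last (l ⊕ unit (Fin.fromℕ n))
      positive l rewrite last≡0 | last-⊕ l (unit (Fin.fromℕ n))
                       | sym (lookup-fromℕ (unit (Fin.fromℕ n)))
                       | Vecₚ.lookup∘update (Fin.fromℕ n) 𝟎 1 = ℕₚ.m≤n+m 1 (last l)

    -- An expression of N by the generators is a monomial of degree N without x, which is smaller
    -- than any monomial of that degree with x.
    standard-S : ∀ {N α₀ αs} → N ∈ S → ¬ Reducible (α₀ ∷ αs) → deg (α₀ ∷ αs) ≡ N → α₀ ≡ 0
    standard-S {α₀ = zero}  _          _   _  = refl
    standard-S {α₀ = suc _} (l , refl) std eq =
      contradiction (0 ∷ l , x-≺ (s≤s z≤n) , sym eq) std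

    T⊆∂ : ∀ {N} → N ∈ T a → N ∈ ∂ a O
    T⊆∂ {N} (N∈Ap , N+aᵢ∉Ap) = _ , B , B-reduced , N∈Ap ,
        monomial (nf (N ∷ 𝟎)) , nf-isNormalForm leads! leads⁻ leads⁺ (N ∷ 𝟎) ,
        init βs , subst (IsExp _≺_ (monomial (nf (N ∷ 𝟎)))) nf≡ (IsExp-monomial (nf (N ∷ 𝟎))) ,
        extremal
      where
      -- The bound of `deg-minimalReducible` for c = aₖ, the exponent in `power-reducible`; the
      -- exceptional variable is yₖ.
      D = aₖ * Vec.sum w
      bound : ∀ {ε} → MinimalReducible ε → deg ε ≤ D
      bound = deg-minimalReducible (Fin.fromℕ (suc n)) aₖ power-reducible
      leads = minimalReducibles D bound
      leads! = minimalReducibles-unique D bound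
      leads⁻ : ∀ {ε} → ε ∈ₗ leads → MinimalReducible ε
      leads⁻ = ∈-minimalReducibles⁻ D bound
      leads⁺ : ∀ {ε} → MinimalReducible ε → ε ∈ₗ leads
      leads⁺ = ∈-minimalReducibles⁺ D bound

      B = basis leads! leads⁻ leads⁺
      B-reduced = basis-reduced leads! leads⁻ leads⁺

      β₀ = Vec.head (nf (N ∷ 𝟎))
      βs = Vec.tail (nf (N ∷ 𝟎))

      nf-∷ : nf (N ∷ 𝟎) ≡ β₀ ∷ βs
      nf-∷ with _ ∷ _ ← nf (N ∷ 𝟎) = refl

      deg-β : deg (β₀ ∷ βs) ≡ N
      deg-β = trans (cong deg (sym nf-∷)) (trans (deg-nf (N ∷ 𝟎)) (deg-x N))

      β₀≡0 : β₀ ≡ 0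
      β₀≡0 = standard-S (proj₁ N∈Ap) (subst (¬_ ∘ Reducible) nf-∷ (nf-standard (N ∷ 𝟎))) deg-β

      dot-βs : dot βs a ≡ N
      dot-βs = trans (cong (λ z → deg (z ∷ βs)) (sym β₀≡0)) deg-β

      βs≡ : βs ≡ init βs ∷ʳ 0
      βs≡ = trans (init-∷ʳ-last βs) (cong (init βs ∷ʳ_)
        (Ap⇒last≡0 βs (subst (_∈ Ap S aₖ) (sym dot-βs) N∈Ap)))

      nf≡ : nf (N ∷ 𝟎) ≡ 0 ∷ (init βs ∷ʳ 0)
      nf≡ = trans nf-∷ (cong₂ _∷_ β₀≡0 βs≡)

      extremal : ∀ i → 0 ∷ ((init βs ∷ʳ 0) ⊕ unit i) ∉ ∁ (E _≺_ B) ∩ x=yₖ=0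
      -- A tuple outside E is standard, and being free of x and yₖ it would put N + aᵢ into the
      -- Apéry set.
      extremal i (∉E , _ , last≡0) = N+aᵢ∉Ap i (subst (_∈ Ap S aₖ)
        (trans (dot-⊕ (init βs ∷ʳ 0) (unit i) a)
          (cong₂ _+_ (trans (cong (λ αs → dot αs a) (sym βs≡)) dot-βs) (dot-unit i a)))
        (standard⇒Ap (∉E ∘ reducible⇒E B-reduced) last≡0))

  -- Criterion (1) excludes x from the smaller monomial. A degree in the Apéry set excludes yₖ from
  -- both, so criterion (2) ties as well, and criterion (3) compares the weights with aᵢ erased.
  preferring-≺ : ∀ i {αs β₀ βs} → let open AperyOrdering (preferring a i) in
    (β₀ ∷ βs) ≺ (0 ∷ αs) → deg (β₀ ∷ βs) ≡ dot αs a → dot αs a ∈ Ap S aₖ →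
    β₀ ≡ 0 × lookup αs i ≤ lookup βs i
  preferring-≺ i {αs} {zero} {βs} (inj₂ (_ , lex)) eq ap = refl ,
    ℕₚ.*-cancelʳ-≤ (lookup αs i) (lookup βs i) (lookup a i) {{a>0 i}}
      (ℕₚ.+-cancelʳ-≤ (dot βs a′) _ _ (begin
        lookup αs i * lookup a i + dot βs a′  ≤⟨ ℕₚ.+-monoʳ-≤ _ (others lex) ⟩
        lookup αs i * lookup a i + dot αs a′  ≡⟨ dot-erase αs a i ⟨
        dot αs a                              ≡⟨ eq ⟨
        dot βs a                              ≡⟨ dot-erase βs a i ⟩
        lookup βs i * lookup a i + dot βs a′  ∎))
    where
    open ℕₚ.≤-Reasoning
    a′ = a [ i ]≔ 0

    α-last : last αs ≡ 0
    α-last = Ap⇒last≡0 αs ap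

    β-last : last βs ≡ 0
    β-last = Ap⇒last≡0 βs (subst (_∈ Ap S aₖ) (sym eq) ap)

    others : ×-Lex _≡_ _<_ (×-Lex _≡_ (weightLex (init a′)) _<_)
               (dot (init βs) (init a) , init βs , last βs)
               (dot (init αs) (init a) , init αs , last αs) →
             dot βs a′ ≤ dot αs a′
    others (inj₁ lt) = contradiction
      (trans (dot-init βs a β-last) (trans eq (sym (dot-init αs a α-last)))) (ℕₚ.<⇒≢ lt)
    others (inj₂ (_ , inj₂ (_ , lt))) =
      contradiction (trans β-last (sym α-last)) (ℕₚ.<⇒≢ lt)
    others (inj₂ (_ , inj₁ lt))
      rewrite sym (dot-init βs a′ β-last) | sym (dot-init αs a′ α-last) with lt
    ... | inj₁ lt′      = ℕₚ.<⇒≤ lt′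
    ... | inj₂ (eq′ , _) = ℕₚ.≤-reflexive eq′

  -- If N + aᵢ were in the Apéry set, a monomial of that degree smaller than yᵢ times the normal
  -- form would itself contain yᵢ, by `preferring-≺`. Cancelling yᵢ would then give a monomial of
  -- degree N below the normal form.
  ∂-preferring : ∀ {N} i → N ∈ ∂ a (preferring a i) → N + lookup a i ∉ Ap S aₖ
  ∂-preferring {N} i (_ , B , B-reduced , N∈Ap , p , p-nf , γ , p-exp , extremal) N+aᵢ∈Ap =
    extremal i (α∉E , refl , Ap⇒last≡0 αs α∈Ap)
    where
    open AperyOrdering (preferring a i)
    open Toric w w>0 isMonomialOrdering
      hiding (deg; push; push-ideal; push-binomial)
    open GröbnerBasis I↦0 binomial-∈I

    γs = γ ∷ʳ 0
    αs = γs ⊕ unit i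

    γ-standard : ¬ Reducible (0 ∷ γs)
    γ-standard = normalForm-standard B-reduced (monomial (N ∷ 𝟎)) p p-nf (proj₁ p-exp)

    dot-γ : dot γs a ≡ N
    dot-γ = trans (deg-normalForm B-reduced (N ∷ 𝟎) p p-nf (proj₁ p-exp)) (deg-x N)

    dot-α : dot αs a ≡ N + lookup a i
    dot-α = trans (dot-⊕ γs (unit i) a) (cong₂ _+_ dot-γ (dot-unit i a))

    α∈Ap : dot αs a ∈ Ap S aₖ
    α∈Ap = subst (_∈ Ap S aₖ) (sym dot-α) N+aᵢ∈Ap

    divisible : 1 ≤ lookup αs i
    divisible rewrite Vecₚ.lookup-zipWith _+_ i γs (unit i) | Vecₚ.lookup∘update i 𝟎 1 =
      ℕₚ.m≤n+m 1 (lookup γs i)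

    α∉E : 0 ∷ αs ∉ E _≺_ B
    α∉E α∈E with E⇒reducible B-reduced α∈E
    ... | β₀ ∷ βs , β≺α , eq with preferring-≺ i {αs} β≺α eq α∈Ap
    ...   | refl , αᵢ≤βᵢ with power-∣ i 1 βs (ℕₚ.≤-trans divisible αᵢ≤βᵢ)
    ...     | δ , refl = γ-standard (0 ∷ δ ,
      ≺-cancelʳ (0 ∷ unit i) (subst (λ βs → (0 ∷ βs) ≺ (0 ∷ αs)) (⊕-comm (unit i) δ) β≺α) ,
      ℕₚ.+-cancelʳ-≡ (dot (unit i) a) (dot δ a) (dot γs a) (begin
        dot δ a + dot (unit i) a    ≡⟨ ℕₚ.+-comm (dot δ a) (dot (unit i) a) ⟩
        dot (unit i) a + dot δ a    ≡⟨ dot-⊕ (unit i) δ a ⟨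
        dot (unit i ⊕ δ) a          ≡⟨ eq ⟩
        dot αs a                    ≡⟨ dot-⊕ γs (unit i) a ⟩
        dot γs a + dot (unit i) a   ∎))
      where open ≡-Reasoning

theorem15 : ∀ n (a : Vec ℕ (suc n)) → gcds a ≡ 1 → (∀ i → NonZero (lookup a i)) →
    ⋂ (AperyOrdering a) (λ ≺ → ∂ a ≺) ≐ T a
theorem15 n a _ a>0 =
  -- Membership in the Apéry set is part of extremality for any single ordering; the index `zero`
  -- supplies one.
  (λ N∈∂ → (let _ , _ , _ , N∈Ap , _ = N∈∂ (preferring a zero) in N∈Ap) ,
           λ i → ∂-preferring i (N∈∂ (preferring a i))) ,
  λ N∈T O → T⊆∂ O N∈T
  where open Apéry a a>0
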